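{- Let $\lambda$ be a partition. For any integer $n\ge 0$, there is a bijection between the set of pairs of reverse plane partitions $(\Lambda,\Lambda')\in\mathrm{RPP}(\lambda)\times\mathrm{RPP}(\lambda)$ satisfying $g(\Lambda,\Lambda')=0$ and having total volume $|\Lambda|+|\Lambda'|=n$, and the set of reverse plane partitions of shape $\lambda$ and volume $n$.
   Context: Partitions and RPPs. $\lambda=(\lambda_1\ge\dots\ge\lambda_\ell>0)$ is an integer partition, $\ell=\ell(\lambda)$, $\lambda'$ is the conjugate partition. The cells of $\lambda$ are the pairs $(i,j)$ with $1\le i\le \ell$, $1\le j\le\lambda_i$ ($i$ is the row, numbered from the bottom, $j$ the column). A reverse plane partition (RPP) of shape $\lambda$ is a map $\Lambda$ from the cells of $\lambda$ to the non-negative integers that is weakly increasing in $i$ and weakly increasing in $j$. $\mathrm{RPP}(\lambda)$ is the set of these, and $|\Lambda|$ (the volume) is the sum of the entries. Conventions: $\Lambda(i,0)=\Lambda(0,j)=0$. Coupled pairs. View an RPP as a stack of $\Lambda(i,j)$ unit cubes over each cell $(i,j)$, in an infinitely tall room whose back wall follows the boundary of $\lambda$, seen from the corner of small $i,j$; this gives a lozenge tiling. A point $(u,v,h)$ ($u$ in the row direction index $i$, $v$ in the column direction index $j$, $h$ height) is projected to horizontal coordinate $v-u$ and vertical coordinate $h+(u+v)/2$. The picture is cut into vertical slices $[d,d+1]$, $d=-\ell,\dots,\lambda_1-1$. A slice $d$ is a hole slice if $d\in H=\{j-1-\lambda'_j:1\le j\le\lambda_1\}$ and a particle slice if $d\in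 D=\{\lambda_i-i:1\le i\le \ell\}$ ($H$ and $D$ partition $\{ -\ell,\dots,\lambda_1-1\}$). There are three lozenge types: top faces of stacks; "left" faces, separating $(i,j-1)$ from $(i,j)$; "right" faces, separating $(i-1,j)$ from $(i,j)$. Recording each lozenge, up to a shift depending only on $d$, by the vertical position of the unit vertical segment at horizontal coordinate $d+1$ (the right edge of a left or right face in slice $d$, or the short diagonal of a top face centred at $d+1$), set - for $d\in H$: $O_d(\Lambda)=\{h+i : (i,j)\in\lambda,\ j-i=d+1,\ h\in\mathbb Z,\ \Lambda(i,j-1)<h\le\Lambda(i,j)\}$ (left faces in slice $d$); - for $d\in D$: $B_d(\Lambda)=\{h+i : (i,j)\in\lambda,\ j-i=d,\ h\in\mathbb Z,\ \Lambda(i-1,j)<h\le\Lambda(i,j)\}$ (right faces in slice $d$); - for all $d$: $T_d(\Lambda)=\{\Lambda(i,j)+i+1 : (i,j)\in\lambda,\ j-i=d+1\}$ (top faces). When the tilings of $\Lambda$ ("blue") and $\Lambda'$ ("red") are superimposed, a coupled pair is one of: (type 1) in a hole slice, a blue left face whose right edge is the short diagonal of a red top face; (type 2) in a hole slice, a blue and a red left face in the same position; (type 3) in a particle slice, a blue and a red right face in the same position; (type 4) in a particle slice, a red right face whose right edge is the short diagonal of a blue top face. Then $g(\Lambda,\Lambda')$ is the number of coupled pairs, i.e. $$g(\Lambda,\Lambda')=\sum_{d\in H}\big(|O_d(\Lambda)\cap T_d(\Lambda')|+|O_d(\Lambda)\cap O_d(\Lambda')|\big)+\sum_{d\in D}\big(|B_d(\Lambda)\cap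 B_d(\Lambda')|+|T_d(\Lambda)\cap B_d(\Lambda')|\big).$$ -}

module Defs where

open import Data.Integer.Base as ℤ using (ℤ; +_)
import Data.Integer.Properties as ℤ
open import Data.List.Base using (List; []; _∷_; length; map; filter; concatMap; applyUpTo; deduplicate)
open import Data.List.Membership.DecPropositional using (_∈?_)
open import Data.List.Relation.Unary.All using (All)
open import Data.List.Relation.Unary.Linked using (Linked)
open import Data.Nat.Base using (ℕ; zero; suc; pred; _+_; _∸_; _≤_; _<_; _≥_)
open import Data.Nat.ListAction using (sum)
open import Data.Nat.Properties using (_≟_; _≤?_)
open import Data.Product.Base using (Σ-syntax; _×_; _,_; proj₁)
open import Data.Product.Relation.Binary.Pointwise.NonDependent using (_×ₛ_)
open import Level using (0ℓ)
open import Relation.Binary.Bundles using (Setoid)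
import Relation.Binary.Construct.On as On
open import Relation.Binary.PropositionalEquality.Core using (_≡_; refl; sym; trans)
open import Relation.Nullary.Decidable.Core using (Dec; yes; no; _×-dec_)

-- Finite sets are given by lists enumerating their elements, possibly with
-- repetitions; cardinalities and sums discard the repetitions.

∣_∩_∣ : List ℕ → List ℕ → ℕ
∣ A ∩ B ∣ = length (deduplicate _≟_ (filter (λ x → _∈?_ _≟_ x B) A))

∑[_] : List ℤ → (ℤ → ℕ) → ℕ
∑[ A ] f = sum (map f (deduplicate ℤ._≟_ A))

-- { h : a < h ≤ b }
⟨_,_] : ℕ → ℕ → List ℕ
⟨ a , b ] = applyUpTo (λ k → suc (a + k)) (b ∸ a)

record Partition : Set where
  field
    parts      : List ℕ
    decreasing : Linked _≥_ parts
    positive   : All (0 <_) parts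

-- Indices start at 1; the value is 0 at index 0 and beyond the last part.
nth : List ℕ → ℕ → ℕ
nth []       _             = 0
nth (x ∷ xs) zero          = 0
nth (x ∷ xs) (suc zero)    = x
nth (x ∷ xs) (suc (suc i)) = nth xs (suc i)

module _ (μ : Partition) where
  open Partition μ

  ℓ : ℕ
  ℓ = length parts

  part : ℕ → ℕ
  part = nth parts

  conjugate : ℕ → ℕ
  conjugate j = length (filter (j ≤?_) parts)

  InShape : ℕ → ℕ → Set
  InShape i j = (1 ≤ i × i ≤ ℓ) × (1 ≤ j × j ≤ part i)

  inShape? : ∀ i j → Dec (InShape i j)
  inShape? i j = (1 ≤? i ×-dec i ≤? ℓ) ×-dec (1 ≤? j ×-dec j ≤? part i)

  record Cell : Set where
    constructor cell
    field
      row col  : ℕ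
      .inShape : InShape row col

  cells : List (ℕ × ℕ)
  cells = concatMap (λ i → map (i ,_) ⟨ 0 , part i ]) ⟨ 0 , ℓ ]

  -- The cells (i , j) with j - i = c.
  diagonal : ℤ → List (ℕ × ℕ)
  diagonal c = filter (λ (i , j) → (+ j ℤ.- + i) ℤ.≟ c) cells

  holes : List ℤ
  holes = map (λ j → + j ℤ.- + 1 ℤ.- + conjugate j) ⟨ 0 , part 1 ]

  particles : List ℤ
  particles = map (λ i → + part i ℤ.- + i) ⟨ 0 , ℓ ]

  record RPP : Set where
    open Cell
    field
      entry   : Cell → ℕ
      row-inc : ∀ c c′ → col c ≡ col c′ → row c ≤ row c′ → entry c ≤ entry c′
      col-inc : ∀ c c′ → row c ≡ row c′ → col c ≤ col c′ → entry c ≤ entry c′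

  rppSetoid : Setoid 0ℓ 0ℓ
  rppSetoid = record
    { Carrier       = RPP
    ; _≈_           = λ Λ Λ′ → ∀ c → RPP.entry Λ c ≡ RPP.entry Λ′ c
    ; isEquivalence = record
      { refl  = λ c → refl
      ; sym   = λ p c → sym (p c)
      ; trans = λ p q c → trans (p c) (q c)
      }
    }

module _ {μ : Partition} where

  -- Λ(i,j), extended by 0 outside the shape.  Below, the only arguments outside
  -- the shape at which it is used are (i,0) and (0,j).
  _⟪_,_⟫ : RPP μ → ℕ → ℕ → ℕ
  Λ ⟪ i , j ⟫ with inShape? μ i j
  ... | yes p = RPP.entry Λ (cell i j p)
  ... | no _  = 0

  volume : RPP μ → ℕ
  volume Λ = sum (map (λ (i , j) → Λ ⟪ i , j ⟫) (cells μ))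

  -- Left, right and top faces (O, B, T) of the lozenge tiling in slice [d , d + 1],
  -- recorded by the height of their unit vertical segment at abscissa d + 1, up to
  -- a shift depending only on d.

  O : ℤ → RPP μ → List ℕ
  O d Λ = concatMap (λ (i , j) → map (_+ i) ⟨ Λ ⟪ i , pred j ⟫ , Λ ⟪ i , j ⟫ ]) (diagonal μ (d ℤ.+ + 1))

  B : ℤ → RPP μ → List ℕ
  B d Λ = concatMap (λ (i , j) → map (_+ i) ⟨ Λ ⟪ pred i , j ⟫ , Λ ⟪ i , j ⟫ ]) (diagonal μ d)

  T : ℤ → RPP μ → List ℕ
  T d Λ = map (λ (i , j) → Λ ⟪ i , j ⟫ + i + 1) (diagonal μ (d ℤ.+ + 1))

  g : RPP μ → RPP μ → ℕ
  g Λ Λ′ =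
      ∑[ holes μ ] (λ d → ∣ O d Λ ∩ T d Λ′ ∣ + ∣ O d Λ ∩ O d Λ′ ∣)
    + ∑[ particles μ ] (λ d → ∣ B d Λ ∩ B d Λ′ ∣ + ∣ T d Λ ∩ B d Λ′ ∣)

module _ (μ : Partition) (n : ℕ) where

  UncoupledPairs : Setoid 0ℓ 0ℓ
  UncoupledPairs = On.setoid {B = Σ[ (Λ , Λ′) ∈ RPP μ × RPP μ ] (g Λ Λ′ ≡ 0 × volume Λ + volume Λ′ ≡ n)} (rppSetoid μ ×ₛ rppSetoid μ) proj₁

  RPPsOfVolume : Setoid 0ℓ 0ℓ
  RPPsOfVolume = On.setoid {B = Σ[ Λ ∈ RPP μ ] volume Λ ≡ n} (rppSetoid μ) proj₁

{-# OPTIONS --safe #-}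
module Submission where

-- Write b = Λ (blue), r = Λ′ (red), and let depth i j be the number of cells of the shape on
-- the diagonal of (i , j) from (i , j) outwards.  A hole slice without coupled pairs propagates
-- b i j ≤ r i j from its left to its right diagonal and r i j ≤ b (i + 1) (j + 1) from its right
-- to its left diagonal; so does a particle slice.  As the former inequality is trivial at the
-- left end and the latter at the right end, both hold everywhere.  Hence on each diagonal the
-- entries of r and b, read from the outermost cell inwards, interleave into one weakly
-- decreasing sequence, and the same local arguments show that the sequences of consecutive
-- diagonals interlace and that the inner half of the entries of b and r vanishes.  So the
-- interleaved sequences form a reverse plane partition of the same total volume, and dealing the
-- entries of each diagonal out alternately to r and b inverts the construction.

open import Defs
open import Data.Empty using (⊥; ⊥-elim)
open import Data.Integer.Base as ℤ using (ℤ) renaming (+_ to pos)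
import Data.Integer.Properties as ℤ
open import Data.Integer.Tactic.RingSolver using (solve-∀)
open import Data.List.Base using (List; []; _∷_; _++_; length; filter; map)
open import Data.List.Membership.DecPropositional using (_∈?_)
open import Data.List.Membership.Propositional using (_∈_; _∉_; find; lose)
open import Data.List.Membership.Propositional.Properties using (∈-map⁺; ∈-map⁻; ∈-filter⁺; ∈-filter⁻; ∈-deduplicate⁺; ∈-deduplicate⁻; ∈-applyUpTo⁺; ∈-applyUpTo⁻; ∈-concatMap⁺; ∈-concatMap⁻; ∈-++⁺ˡ; ∈-++⁺ʳ; ∈-++⁻)
open import Data.List.Membership.Propositional.Properties.WithK using (unique∧set⇒bag)
open import Data.List.Properties using (filter-accept; filter-reject; filter-none; map-∘; map-id; map-cong; map-cong-local; map-++)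
open import Data.List.Relation.Binary.BagAndSetEquality using (∼bag⇒↭)
open import Data.List.Relation.Binary.Permutation.Propositional using (_↭_)
import Data.List.Relation.Binary.Permutation.Propositional.Properties as ↭
open import Data.List.Relation.Unary.All as All using (All; []; _∷_)
import Data.List.Relation.Unary.All.Properties as All
import Data.List.Relation.Unary.AllPairs as AllPairs
import Data.List.Relation.Unary.AllPairs.Properties as AllPairs
open import Data.List.Relation.Unary.Any using (here; there)
open import Data.List.Relation.Unary.Linked using (Linked; []; [-]; _∷_)
open import Data.List.Relation.Unary.Unique.Propositional using (Unique)
import Data.List.Relation.Unary.Unique.Propositional.Properties as Unique
open import Data.Nat.Base
open import Data.Nat.ListAction using (sum)
open import Data.Nat.ListAction.Properties using (sum-↭; sum-++)
open import Data.Nat.Properties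
open import Algebra.Properties.CommutativeSemigroup +-commutativeSemigroup using (interchange; x∙yz≈y∙xz; xy∙z≈y∙xz)
open import Data.Product.Base using (∃; ∃₂; _×_; _,_; proj₁; proj₂)
open import Data.Sum.Base as Sum using (_⊎_; inj₁; inj₂)
open import Function.Base using (_∘_)
open import Function.Bundles using (Bijection; Inverse; mk⇔)
open import Function.Properties.Inverse using (Inverse⇒Bijection)
open import Relation.Binary.PropositionalEquality hiding (J)
open import Relation.Nullary using (¬_; Dec; yes; no; contradiction)
open import Relation.Nullary.Decidable using (map′; recompute)

-- Vanishing sums, empty intersections and reindexing of sums over lists

∈⇒≤sum : ∀ {x xs} → x ∈ xs → x ≤ sum xs
∈⇒≤sum {xs = y ∷ xs} (here refl)  = m≤m+n y (sum xs)
∈⇒≤sum {xs = y ∷ xs} (there x∈xs) = ≤-trans (∈⇒≤sum x∈xs) (m≤n+m (sum xs) y)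

sum-map-zero : ∀ {a} {A : Set a} (f : A → ℕ) xs → (∀ {x} → x ∈ xs → f x ≡ 0) → sum (map f xs) ≡ 0
sum-map-zero f []       z = refl
sum-map-zero f (x ∷ xs) z = cong₂ _+_ (z (here refl)) (sum-map-zero f xs (z ∘ there))

∑-zero⁺ : ∀ A {f} → (∀ {d} → d ∈ A → f d ≡ 0) → ∑[ A ] f ≡ 0
∑-zero⁺ A {f} z = sum-map-zero f _ (z ∘ ∈-deduplicate⁻ ℤ._≟_ A)

∑-zero⁻ : ∀ {A f d} → ∑[ A ] f ≡ 0 → d ∈ A → f d ≡ 0
∑-zero⁻ {A} {f} z d∈A = n≤0⇒n≡0 (≤-trans (∈⇒≤sum (∈-map⁺ f (∈-deduplicate⁺ ℤ._≟_ d∈A))) (≤-reflexive z))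

∩-empty⁺ : ∀ A B → (∀ {x} → x ∈ A → x ∈ B → ⊥) → ∣ A ∩ B ∣ ≡ 0
∩-empty⁺ A B disjoint
  rewrite filter-none (λ x → _∈?_ _≟_ x B) {A} (All.tabulate λ x∈A x∈B → disjoint x∈A x∈B) = refl

∩-empty⁻ : ∀ {A B x} → ∣ A ∩ B ∣ ≡ 0 → x ∈ A → x ∈ B → ⊥
∩-empty⁻ {A} {B} eq x∈A x∈B = nonempty eq (∈-deduplicate⁺ _≟_ (∈-filter⁺ (λ x → _∈?_ _≟_ x B) x∈A x∈B))
  where
  nonempty : ∀ {x} {xs : List ℕ} → length xs ≡ 0 → x ∈ xs → ⊥
  nonempty () (here _)
  nonempty () (there _)

∈⟨]⁺ : ∀ {a b h} → a < h → h ≤ b → h ∈ ⟨ a , b ]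
∈⟨]⁺ {a} {b} {h} a<h h≤b = subst (_∈ ⟨ a , b ]) (m+[n∸m]≡n a<h)
  (∈-applyUpTo⁺ (λ k → suc (a + k)) (≤-trans (≤-reflexive (sym (+-∸-assoc 1 a<h))) (∸-monoˡ-≤ a h≤b)))

∈⟨]⁻ : ∀ {a b h} → h ∈ ⟨ a , b ] → a < h × h ≤ b
∈⟨]⁻ {a} {b} h∈ with ∈-applyUpTo⁻ (λ k → suc (a + k)) h∈
... | k , k<b∸a , refl = s≤s (m≤m+n a k) ,
  ≤-trans (≤-reflexive (sym (+-suc a k))) (≤-trans (+-monoʳ-≤ a k<b∸a) (≤-reflexive (m+[n∸m]≡n (<⇒≤ a<b))))
  where
  a<b : a < b
  a<b = m∸n≢0⇒n<m {b} {a} (>⇒≢ (≤-trans (s≤s z≤n) k<b∸a))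

⟨]-unique : ∀ a b → Unique ⟨ a , b ]
⟨]-unique a b = Unique.applyUpTo⁺₁ _ (b ∸ a) λ i<j _ eq → <⇒≢ i<j (+-cancelˡ-≡ a _ _ (suc-injective eq))

sum-filter : ∀ {a p} {A : Set a} {P : A → Set p} (P? : ∀ x → Dec (P x)) (f : A → ℕ) xs →
  (∀ {x} → ¬ P x → f x ≡ 0) → sum (map f (filter P? xs)) ≡ sum (map f xs)
sum-filter P? f []       z = refl
sum-filter P? f (x ∷ xs) z with P? x
... | yes p = cong (f x +_) (sum-filter P? f xs z)
... | no ¬p = trans (sum-filter P? f xs z) (cong (_+ sum (map f xs)) (sym (z ¬p)))

-- The terms of `xs` whose image lies outside `ys` vanish. On the remaining ones `t` and `s` are
-- mutually inverse, so up to order they form the list `map s ys`.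
sum-reindex : ∀ {a b} {A : Set a} {B : Set b} {xs : List A} {ys : List B} (t : A → B) (s : B → A) →
  Unique xs → Unique ys → (∀ y → Dec (y ∈ ys)) →
  (∀ {y} → y ∈ ys → s y ∈ xs × t (s y) ≡ y) → (∀ {x} → x ∈ xs → t x ∈ ys → s (t x) ≡ x) →
  (f : B → ℕ) → (∀ {y} → y ∉ ys → f y ≡ 0) → sum (map (f ∘ t) xs) ≡ sum (map f ys)
sum-reindex {xs = xs} {ys} t s xs! ys! ys? s-in t-in f f-off = begin
  sum (map (f ∘ t) xs)                    ≡⟨ sum-filter (ys? ∘ t) (f ∘ t) xs f-off ⟨
  sum (map (f ∘ t) (filter (ys? ∘ t) xs)) ≡⟨ sum-↭ (↭.map⁺ (f ∘ t) perm) ⟩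
  sum (map (f ∘ t) (map s ys))            ≡⟨ cong sum (map-∘ ys) ⟨
  sum (map (f ∘ t ∘ s) ys)                ≡⟨ cong sum (map-cong-local (All.tabulate λ y∈ → cong f (proj₂ (s-in y∈)))) ⟩
  sum (map f ys)                          ∎
  where
  open ≡-Reasoning
  ts≡id : map t (map s ys) ≡ ys
  ts≡id = trans (sym (map-∘ ys)) (trans (map-cong-local (All.tabulate λ y∈ → proj₂ (s-in y∈))) (map-id ys))
  s! : Unique (map s ys)
  -- A repetition in `map s ys` would be carried by `t` to one in `ys`.
  s! = AllPairs.map (λ ne eq → ne (cong t eq)) (AllPairs.map⁻ (subst Unique (sym ts≡id) ys!))
  to : ∀ {x} → x ∈ filter (ys? ∘ t) xs → x ∈ map s ys
  to x∈ with ∈-filter⁻ (ys? ∘ t) {xs = xs} x∈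
  ... | x∈xs , tx∈ys = subst (_∈ map s ys) (t-in x∈xs tx∈ys) (∈-map⁺ s tx∈ys)
  from : ∀ {x} → x ∈ map s ys → x ∈ filter (ys? ∘ t) xs
  from x∈ with ∈-map⁻ s x∈
  ... | y , y∈ys , refl = ∈-filter⁺ (ys? ∘ t) (proj₁ (s-in y∈ys)) (subst (_∈ ys) (sym (proj₂ (s-in y∈ys))) y∈ys)
  perm : filter (ys? ∘ t) xs ↭ map s ys
  perm = ∼bag⇒↭ (unique∧set⇒bag (Unique.filter⁺ (ys? ∘ t) xs!) s! (mk⇔ to from))

-- Diagonals as integer differences

difference-injective : ∀ a b c d → pos a ℤ.- pos b ≡ pos c ℤ.- pos d → a + d ≡ c + b
difference-injective a b c d eq = ℤ.+-injective (begin
  pos a ℤ.+ pos d                            ≡⟨ shift (pos a) (pos b) (pos d) ⟩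
  (pos a ℤ.- pos b) ℤ.+ (pos b ℤ.+ pos d)        ≡⟨ cong (λ x → x ℤ.+ (pos b ℤ.+ pos d)) eq ⟩
  (pos c ℤ.- pos d) ℤ.+ (pos b ℤ.+ pos d)        ≡⟨ cong (λ x → (pos c ℤ.- pos d) ℤ.+ x) (ℤ.+-comm (pos b) (pos d)) ⟩
  (pos c ℤ.- pos d) ℤ.+ (pos d ℤ.+ pos b)        ≡⟨ shift (pos c) (pos d) (pos b) ⟨
  pos c ℤ.+ pos b                            ∎)
  where
  open ≡-Reasoning
  shift : ∀ x y z → x ℤ.+ z ≡ (x ℤ.- y) ℤ.+ (y ℤ.+ z)
  shift = solve-∀

difference-cong : ∀ a b c d → a + d ≡ c + b → pos a ℤ.- pos b ≡ pos c ℤ.- pos d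
difference-cong a b c d eq = begin
  pos a ℤ.- pos b                                ≡⟨ expand (pos a) (pos d) (pos b) ⟩
  (pos a ℤ.+ pos d) ℤ.- (pos b ℤ.+ pos d)            ≡⟨ cong (λ x → pos x ℤ.- (pos b ℤ.+ pos d)) eq ⟩
  (pos c ℤ.+ pos b) ℤ.- (pos b ℤ.+ pos d)            ≡⟨ cong (λ x → (pos c ℤ.+ pos b) ℤ.- x) (ℤ.+-comm (pos b) (pos d)) ⟩
  (pos c ℤ.+ pos b) ℤ.- (pos d ℤ.+ pos b)            ≡⟨ expand (pos c) (pos b) (pos d) ⟨
  pos c ℤ.- pos d                                ∎
  where
  open ≡-Reasoning
  expand : ∀ x y z → x ℤ.- z ≡ (x ℤ.+ y) ℤ.- (z ℤ.+ y)
  expand = solve-∀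

hole-position : ∀ J I → (J ℤ.- pos 1 ℤ.- I) ℤ.+ pos 1 ≡ J ℤ.- I
hole-position = solve-∀

particle-position : ∀ J I → (J ℤ.- I) ℤ.+ pos 1 ≡ (pos 1 ℤ.+ J) ℤ.- I
particle-position = solve-∀

-- Parts of a partition and its conjugate

nth-step : ∀ {xs} → Linked _≥_ xs → ∀ i → nth xs (2 + i) ≤ nth xs (1 + i)
nth-step []        i       = z≤n
nth-step [-]       i       = z≤n
nth-step (x≥y ∷ l) zero    = x≥y
nth-step (x≥y ∷ l) (suc i) = nth-step l i

nth-antitone : ∀ {xs} → Linked _≥_ xs → ∀ {i i′} → 1 ≤ i → i ≤ i′ → nth xs i′ ≤ nth xs i
nth-antitone {xs} l {suc i} (s≤s z≤n) (s≤s i≤i′) = go (≤⇒≤′ i≤i′)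
  where
  go : ∀ {i′} → i ≤′ i′ → nth xs (suc i′) ≤ nth xs (suc i)
  go ≤′-refl        = ≤-refl
  go (≤′-step i≤′n) = ≤-trans (nth-step l _) (go i≤′n)

nth-positive⇒index-bounded : ∀ xs i → 1 ≤ nth xs i → i ≤ length xs
nth-positive⇒index-bounded (x ∷ xs) (suc zero)    p = s≤s z≤n
nth-positive⇒index-bounded (x ∷ xs) (suc (suc i)) p = s≤s (nth-positive⇒index-bounded xs (suc i) p)

nth-positive : ∀ {xs} → All (0 <_) xs → ∀ i → 1 ≤ i → i ≤ length xs → 0 < nth xs i
nth-positive (px ∷ pxs) (suc zero)    _ _        = px
nth-positive (px ∷ pxs) (suc (suc i)) _ (s≤s i≤) = nth-positive pxs (suc i) (s≤s z≤n) i≤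

tail-linked : ∀ {x xs} → Linked _≥_ (x ∷ xs) → Linked _≥_ xs
tail-linked [-]     = []
tail-linked (_ ∷ l) = l

module _ {j : ℕ} (1≤j : 1 ≤ j) where

  -- As the parts decrease, those that are at least `j` form an initial segment. With the converse
  -- below this is the duality between a partition and its conjugate.
  ≤count⇒≤nth : ∀ {xs} → Linked _≥_ xs → ∀ i → 1 ≤ i → i ≤ length (filter (j ≤?_) xs) → j ≤ nth xs i
  ≤count⇒≤nth {[]}     l (suc i) _ ()
  ≤count⇒≤nth {x ∷ xs} l (suc i) 1≤i i≤ with j ≤? x
  ... | no j≰x = contradiction (≤-trans j≤ (nth-antitone l {1} {2 + i} ≤-refl (s≤s z≤n))) j≰x
    where
    j≤ : j ≤ nth xs (suc i)
    j≤ = ≤count⇒≤nth (tail-linked l) (suc i) 1≤i (≤-trans i≤ (≤-reflexive (cong length (filter-reject (j ≤?_) {x} {xs} j≰x))))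
  ... | yes j≤x with i | ≤-trans i≤ (≤-reflexive (cong length (filter-accept (j ≤?_) {x} {xs} j≤x)))
  ...   | zero  | _       = j≤x
  ...   | suc i | s≤s i≤′ = ≤count⇒≤nth (tail-linked l) (suc i) (s≤s z≤n) i≤′

  ≤nth⇒≤count : ∀ {xs} → Linked _≥_ xs → ∀ i → j ≤ nth xs i → i ≤ length (filter (j ≤?_) xs)
  ≤nth⇒≤count {[]}     l i j≤ = contradiction (≤-trans 1≤j j≤) λ ()
  ≤nth⇒≤count {x ∷ xs} l zero j≤ = z≤n
  ≤nth⇒≤count {x ∷ xs} l (suc i) j≤ = ≤-trans (s≤s (go i j≤)) (≤-reflexive (cong length (sym accept)))
    where
    accept : filter (j ≤?_) (x ∷ xs) ≡ x ∷ filter (j ≤?_) xs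
    accept = filter-accept (j ≤?_) (≤-trans j≤ (nth-antitone l {1} {suc i} ≤-refl (s≤s z≤n)))
    go : ∀ i → j ≤ nth (x ∷ xs) (suc i) → i ≤ length (filter (j ≤?_) xs)
    go zero    _  = z≤n
    go (suc i) j≤ = ≤nth⇒≤count (tail-linked l) (suc i) j≤

≤∧≡0⇒≡0 : ∀ {m n} → m ≤ n → n ≡ 0 → m ≡ 0
≤∧≡0⇒≡0 m≤n refl = n≤0⇒n≡0 m≤n

suc-∸ : ∀ m {n} → 0 < n → suc m ∸ n ≡ m ∸ (n ∸ 1)
suc-∸ m (s≤s _) = refl

-- For two cells on one diagonal, with columns `m` and `o` in rows `p` and `n`, this turns a
-- comparison of rows into one of columns.
+-≡∧≤⇒≥ : ∀ m {n} o {p} → m + n ≡ o + p → n ≤ p → o ≤ m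
+-≡∧≤⇒≥ m {n} o {p} eq n≤p = +-cancelʳ-≤ n o m (≤-trans (+-monoʳ-≤ o n≤p) (≤-reflexive (sym eq)))

-- J - I ≡ j - i and j - i ≡ l - k imply J - I ≡ l - k.
diagonal-shift : ∀ J {I i k} j l → j + k ≡ l + i → J + i ≡ j + I → J + k ≡ l + I
diagonal-shift J {I} {i} {k} j l eq e = +-cancelʳ-≡ (i + j) (J + k) (l + I) (begin
  (J + k) + (i + j)  ≡⟨ interchange J k i j ⟩
  (J + i) + (k + j)  ≡⟨ cong ((J + i) +_) (+-comm k j) ⟩
  (J + i) + (j + k)  ≡⟨ cong₂ _+_ e eq ⟩
  (j + I) + (l + i)  ≡⟨ +-comm (j + I) (l + i) ⟩
  (l + i) + (j + I)  ≡⟨ cong ((l + i) +_) (+-comm j I) ⟩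
  (l + i) + (I + j)  ≡⟨ interchange l i I j ⟩
  (l + I) + (i + j)  ∎)
  where open ≡-Reasoning

-- Interleaving two colours along a diagonal

data Colour : Set where
  blue red : Colour

bit : Colour → ℕ
bit blue = 0
bit red  = 1

-- Each diagonal step outwards uses up two units of the first argument, and the remaining parity is
-- the colour. Started with the depth of `(i , j)`, this finds the coloured cell whose entry the
-- merged filling takes at `(i , j)`.
source : ℕ → ℕ → ℕ → Colour × ℕ × ℕ
source 0             i j = blue , i , j
source 1             i j = red , i , j
source (suc (suc e)) i j = source e (suc i) (suc j)

source-double : ∀ c k i j → source (bit c + (k + k)) i j ≡ (c , k + i , k + j)
source-double blue zero    i j = refl
source-double red  zero    i j = refl
source-double blue (suc k) i j rewrite +-suc k k =
  trans (source-double blue k (suc i) (suc j)) (cong₂ (λ x y → blue , x , y) (+-suc k i) (+-suc k j))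
source-double red  (suc k) i j rewrite +-suc k k =
  trans (source-double red k (suc i) (suc j)) (cong₂ (λ x y → red , x , y) (+-suc k i) (+-suc k j))

halve : ∀ e → ∃₂ λ c k → e ≡ bit c + (k + k)
halve 0 = blue , 0 , refl
halve 1 = red , 0 , refl
halve (suc (suc e)) with halve e
... | blue , k , refl = blue , suc k , cong suc (sym (+-suc k k))
... | red  , k , refl = red , suc k , cong (2 +_) (sym (+-suc k k))

-- Cells of the shape and depths along diagonals

module Shape (μ : Partition) where
  open Partition μ

  S : ℕ → ℕ → Set
  S = InShape μ

  S-row : ∀ {i j} → S i j → 1 ≤ i
  S-row ((1≤i , _) , _) = 1≤i

  S-col : ∀ {i j} → S i j → 1 ≤ j
  S-col (_ , (1≤j , _)) = 1≤j

  S-row≤ℓ : ∀ {i j} → S i j → i ≤ ℓ μ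
  S-row≤ℓ ((_ , i≤ℓ) , _) = i≤ℓ

  S-col≤part : ∀ {i j} → S i j → j ≤ part μ i
  S-col≤part (_ , (_ , j≤)) = j≤

  S-intro : ∀ {i j} → 1 ≤ i → 1 ≤ j → j ≤ part μ i → S i j
  S-intro 1≤i 1≤j j≤ = (1≤i , nth-positive⇒index-bounded parts _ (≤-trans 1≤j j≤)) , (1≤j , j≤)

  S-down : ∀ {i j x y} → 1 ≤ x → 1 ≤ y → x ≤ i → y ≤ j → S i j → S x y
  S-down 1≤x 1≤y x≤i y≤j s =
    S-intro 1≤x 1≤y (≤-trans y≤j (≤-trans (S-col≤part s) (nth-antitone decreasing 1≤x x≤i)))

  S-col≤part₁ : ∀ {i j} → S i j → j ≤ part μ 1
  S-col≤part₁ s = S-col≤part (S-down ≤-refl (S-col s) (S-row s) ≤-refl s)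

  -- This bound and the next confine the diagonals of the shape to a finite range; they close the
  -- base cases of the inductions over diagonals.
  left-bound : ∀ {i j} → S i j → ¬ j + ℓ μ ≤ i
  left-bound {j = j} s le = contradiction (≤-trans (S-col s) (+-cancelʳ-≤ (ℓ μ) j 0 (≤-trans le (S-row≤ℓ s)))) λ ()

  right-bound : ∀ {i j} → S i j → ¬ part μ 1 + i ≤ j
  right-bound s le = <-irrefl refl (≤-trans (m<m+n _ (S-row s)) (≤-trans le (S-col≤part₁ s)))

  S-pred : ∀ {i j} → 1 ≤ i → 1 ≤ j → S (suc i) (suc j) → S i j
  S-pred 1≤i 1≤j = S-down 1≤i 1≤j (n≤1+n _) (n≤1+n _)

  ≤conjugate⇒S : ∀ {i j} → 1 ≤ i → 1 ≤ j → i ≤ conjugate μ j → S i j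
  ≤conjugate⇒S 1≤i 1≤j i≤ = S-intro 1≤i 1≤j (≤count⇒≤nth 1≤j decreasing _ 1≤i i≤)

  S⇒≤conjugate : ∀ {i j} → S i j → i ≤ conjugate μ j
  S⇒≤conjugate s = ≤nth⇒≤count (S-col s) decreasing _ (S-col≤part s)

  -- The first argument is fuel. The value `ℓ μ` suffices, since the cells of a diagonal lie in
  -- distinct rows.
  run : ℕ → ℕ → ℕ → ℕ
  run zero    i j = 0
  run (suc n) i j with inShape? μ i j
  ... | yes _ = suc (run n (suc i) (suc j))
  ... | no  _ = 0

  -- The number of cells (i + s , j + s), s ≥ 0, of the shape.
  depth : ℕ → ℕ → ℕ
  depth = run (ℓ μ)

  <run⇒S : ∀ n i j s → s < run n i j → S (s + i) (s + j)
  <run⇒S (suc n) i j s s< with inShape? μ i j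
  <run⇒S (suc n) i j zero    s<       | yes p = p
  <run⇒S (suc n) i j (suc s) (s≤s s<) | yes p =
    subst₂ S (+-suc s i) (+-suc s j) (<run⇒S n (suc i) (suc j) s s<)

  S⇒<run : ∀ n i j s → 1 ≤ i → 1 ≤ j → s < n → S (s + i) (s + j) → s < run n i j
  S⇒<run (suc n) i j s 1≤i 1≤j s<n p with inShape? μ i j
  S⇒<run (suc n) i j zero    1≤i 1≤j s<n       p | yes _ = s≤s z≤n
  S⇒<run (suc n) i j (suc s) 1≤i 1≤j (s≤s s<n) p | yes _ =
    s≤s (S⇒<run n (suc i) (suc j) s (s≤s z≤n) (s≤s z≤n) s<n (subst₂ S (sym (+-suc s i)) (sym (+-suc s j)) p))
  ... | no ¬p = contradiction (S-down 1≤i 1≤j (m≤n+m i s) (m≤n+m j s) p) ¬p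

  <depth⇒S : ∀ {i j} s → s < depth i j → S (s + i) (s + j)
  <depth⇒S = <run⇒S (ℓ μ) _ _

  S⇒<depth : ∀ {i j} s → 1 ≤ i → 1 ≤ j → S (s + i) (s + j) → s < depth i j
  S⇒<depth {i} {j} s 1≤i 1≤j p = S⇒<run (ℓ μ) i j s 1≤i 1≤j
    (≤-trans (subst (_≤ s + i) (+-comm s 1) (+-monoʳ-≤ s 1≤i)) (S-row≤ℓ p)) p

  S⇒0<depth : ∀ {i j} → S i j → 0 < depth i j
  S⇒0<depth p = S⇒<depth 0 (S-row p) (S-col p) p

  depth-off : ∀ {i j} → ¬ S i j → depth i j ≡ 0
  depth-off {i} {j} ¬p with depth i j in eq
  ... | zero  = refl
  ... | suc _ = contradiction (<depth⇒S 0 (subst (0 <_) (sym eq) (s≤s z≤n))) ¬p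

  -- If the depth at `(i , j)` were larger, the cell `depth x y` steps out from there would put into
  -- the shape a cell beyond the last one on the diagonal of `(x , y)`.
  depth-mono : ∀ {i j x y} → 1 ≤ x → 1 ≤ y → (∀ s → S (s + i) (s + j) → S (s + x) (s + y)) → depth i j ≤ depth x y
  depth-mono {i} {j} {x} {y} 1≤x 1≤y f = ≮⇒≥ λ d< →
    <-irrefl refl (S⇒<depth (depth x y) 1≤x 1≤y (f _ (<depth⇒S (depth x y) d<)))

  depth-antitone : ∀ {i j x y} → 1 ≤ x → 1 ≤ y → x ≤ i → y ≤ j → depth i j ≤ depth x y
  depth-antitone 1≤x 1≤y x≤i y≤j = depth-mono 1≤x 1≤y λ s →
    S-down (≤-trans 1≤x (m≤n+m _ s)) (≤-trans 1≤y (m≤n+m _ s)) (+-monoʳ-≤ s x≤i) (+-monoʳ-≤ s y≤j)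

  depth-suc : ∀ {i j} → S i j → depth i j ≡ suc (depth (suc i) (suc j))
  depth-suc {i} {j} p = ≤-antisym d≤ d≥
    where
    d≥ : suc (depth (suc i) (suc j)) ≤ depth i j
    d≥ with depth (suc i) (suc j) in eq
    ... | zero  = S⇒0<depth p
    ... | suc e = S⇒<depth (suc e) (S-row p) (S-col p)
      (subst₂ S (+-suc e i) (+-suc e j) (<depth⇒S e (subst (e <_) (sym eq) ≤-refl)))
    d≤ : depth i j ≤ suc (depth (suc i) (suc j))
    d≤ with depth i j in eq
    ... | zero        = z≤n
    ... | suc zero    = s≤s z≤n
    ... | suc (suc e) = s≤s (S⇒<depth e (s≤s z≤n) (s≤s z≤n)
      (subst₂ S (sym (+-suc e i)) (sym (+-suc e j)) (<depth⇒S (suc e) (subst (suc e <_) (sym eq) ≤-refl))))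

  depth-+ : ∀ k {i j} → 1 ≤ i → 1 ≤ j → S (k + i) (k + j) → depth i j ≡ k + depth (k + i) (k + j)
  depth-+ zero    1≤i 1≤j p = refl
  depth-+ (suc k) {i} {j} 1≤i 1≤j p = begin
    depth i j                                        ≡⟨ depth-+ k 1≤i 1≤j q ⟩
    k + depth (k + i) (k + j)                        ≡⟨ cong (k +_) (depth-suc q) ⟩
    k + suc (depth (suc (k + i)) (suc (k + j)))      ≡⟨ +-suc k _ ⟩
    suc (k + depth (suc (k + i)) (suc (k + j)))      ∎
    where
    open ≡-Reasoning
    q : S (k + i) (k + j)
    q = S-pred (≤-trans 1≤i (m≤n+m i k)) (≤-trans 1≤j (m≤n+m j k)) p

  1<depth⇒S : ∀ {i j} → 1 < depth i j → S (suc i) (suc j)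
  1<depth⇒S = <depth⇒S 1

  -- Hole slices and particle slices

  -- Hole i j and Particle i j say that the slice [ j - i , j - i + 1 ] is a hole slice,
  -- respectively a particle slice; (I , J) is the cell (λ′_J , J), respectively (I , λ_I).

  record Hole (i j : ℕ) : Set where
    constructor hole
    field
      {I J} : ℕ
      in-S  : S I J
      out-S : ¬ S (suc I) J
      slice : J + i ≡ suc (j + I)

  record Particle (i j : ℕ) : Set where
    constructor particle
    field
      {I J} : ℕ
      in-S  : S I J
      out-S : ¬ S I (suc J)
      slice : J + i ≡ j + I

  Hole-suc : ∀ {i j} → Hole i j → Hole (suc i) (suc j)
  Hole-suc (hole p q e) = hole p q (trans (+-suc _ _) (cong suc e))

  Hole-pred : ∀ {i j} → Hole (suc i) (suc j) → Hole i j
  Hole-pred (hole p q e) = hole p q (suc-injective (trans (sym (+-suc _ _)) e))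

  Particle-suc : ∀ {i j} → Particle i j → Particle (suc i) (suc j)
  Particle-suc (particle p q e) = particle p q (trans (+-suc _ _) (cong suc e))

  Particle-pred : ∀ {i j} → Particle (suc i) (suc j) → Particle i j
  Particle-pred (particle p q e) = particle p q (suc-injective (trans (sym (+-suc _ _)) e))

  -- The cells `(i , suc j)` and `(I , J)` share a diagonal. Either the former is the inner one,
  -- hence in the shape, or `(i , j)` dominates `(suc I , J)`, which is not in the shape.
  Hole⇒S-right : ∀ {i j} → Hole i j → S i j → S i (suc j)
  Hole⇒S-right {i} {j} (hole {I} {J} p q e) s with i ≤? I
  ... | yes i≤I = S-down (S-row s) (s≤s z≤n) i≤I (+-≡∧≤⇒≥ J (suc j) e i≤I) p
  ... | no  i≰I = contradiction (S-down (s≤s z≤n) (S-col p) (≰⇒> i≰I) J≤j s) q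
    where
    J≤j : J ≤ j
    J≤j = +-≡∧≤⇒≥ j J (trans (+-suc j I) (sym e)) (≰⇒> i≰I)

  -- The cells `(suc i , suc j)` and `(I , J)` share a diagonal. Either the former is the inner one,
  -- or `(i , suc j)` dominates `(I , suc J)`, which is not in the shape.
  Particle⇒S-up : ∀ {i j} → Particle i j → S i (suc j) → S (suc i) (suc j)
  Particle⇒S-up {i} {j} (particle {I} {J} p q e) s with I ≤? i
  ... | yes I≤i = contradiction (S-down (S-row p) (s≤s z≤n) I≤i (s≤s (+-≡∧≤⇒≥ j J (sym e) I≤i)) s) q
  ... | no  I≰i = S-down (s≤s z≤n) (s≤s z≤n) (≰⇒> I≰i) sj≤J p
    where
    sj≤J : suc j ≤ J
    sj≤J = +-≡∧≤⇒≥ J (suc j) (trans (+-suc J i) (cong suc e)) (≰⇒> I≰i)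

  Hole-+ : ∀ s {i j} → Hole i j → Hole (s + i) (s + j)
  Hole-+ zero    h = h
  Hole-+ (suc s) h = Hole-suc (Hole-+ s h)

  Particle-+ : ∀ s {i j} → Particle i j → Particle (s + i) (s + j)
  Particle-+ zero    h = h
  Particle-+ (suc s) h = Particle-suc (Particle-+ s h)

  -- Every cell left of a hole slice has its right neighbour in the shape, so the two diagonals end
  -- together. Hence a step to the right keeps the depth across a hole slice, while across a
  -- particle slice it lowers the depth by one; for a step upwards the roles are exchanged.
  Hole⇒depth-right : ∀ {i j} → 1 ≤ i → 1 ≤ j → Hole i j → depth i (suc j) ≡ depth i j
  Hole⇒depth-right {i} {j} 1≤i 1≤j h = ≤-antisym
    (depth-antitone 1≤i 1≤j ≤-refl (n≤1+n _))
    (depth-mono 1≤i (s≤s z≤n) λ s p → subst (S (s + i)) (sym (+-suc s j)) (Hole⇒S-right (Hole-+ s h) p))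

  Particle⇒depth-up : ∀ {i j} → 1 ≤ i → Particle i j → depth (suc i) (suc j) ≡ depth i (suc j)
  Particle⇒depth-up {i} {j} 1≤i h = ≤-antisym
    (depth-antitone 1≤i (s≤s z≤n) (n≤1+n _) ≤-refl)
    (depth-mono (s≤s z≤n) (s≤s z≤n) λ s p →
      subst₂ S (sym (+-suc s i)) (sym (+-suc s j)) (Particle⇒S-up (Particle-+ s h) (subst (S (s + i)) (+-suc s j) p)))

  Hole⇒depth-up : ∀ {i j} → S i (suc j) → Hole i j → depth i (suc j) ≡ suc (depth (suc i) (suc j))
  Hole⇒depth-up p h = trans (depth-suc p) (cong suc (Hole⇒depth-right (s≤s z≤n) (s≤s z≤n) (Hole-suc h)))

  Particle⇒depth-right : ∀ {i j} → S i j → Particle i j → depth i j ≡ suc (depth i (suc j))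
  Particle⇒depth-right p h = trans (depth-suc p) (cong suc (Particle⇒depth-up (S-row p) h))

  last-on-diagonal : ∀ {i j} → S i j → ∃ λ e → S (e + i) (e + j) × ¬ S (suc e + i) (suc e + j)
  last-on-diagonal {i} {j} p with depth i j in eq
  ... | zero  = contradiction (S⇒0<depth p) (subst (λ d → ¬ 0 < d) (sym eq) λ ())
  ... | suc e = e , <depth⇒S e (subst (e <_) (sym eq) ≤-refl) , λ q →
    <-irrefl (sym eq) (S⇒<depth (suc e) (S-row p) (S-col p) q)

  -- The outermost cell on the diagonal decides: if its right neighbour is in the shape, that
  -- neighbour is the top of its column; otherwise the cell itself ends its row.
  slice-right : ∀ {i j} → S i j → Hole i j ⊎ Particle i j
  slice-right {i} {j} p with last-on-diagonal p
  ... | e , q , ¬q with inShape? μ (e + i) (suc e + j)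
  ...   | yes r = inj₁ (hole r ¬q (cong suc (xy∙z≈y∙xz e j i)))
  ...   | no ¬r = inj₂ (particle q ¬r (xy∙z≈y∙xz e j i))

  -- Again the outermost cell decides: if the cell above it is in the shape, that cell ends its row;
  -- otherwise the outermost cell is the top of its column.
  slice-left : ∀ {i j} → S i (suc j) → Hole i j ⊎ Particle i j
  slice-left {i} {j} p with last-on-diagonal p
  ... | e , q , ¬q with inShape? μ (suc e + i) (e + suc j)
  ...   | yes r = inj₂ (particle r ¬q (trans (xy∙z≈y∙xz e (suc j) i) (sym (+-suc j (e + i)))))
  ...   | no ¬r = inj₁ (hole q ¬r (xy∙z≈y∙xz e (suc j) i))

  -- Merging and splitting fillings

  -- Reverse plane partitions extended by 0 to all index pairs. The implication in `mono` lets the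
  -- smaller cell lie outside the shape, as in row or column 0, without a separate case.
  record IsFilling (f : ℕ → ℕ → ℕ) : Set where
    field
      off  : ∀ {i j} → ¬ S i j → f i j ≡ 0
      mono : ∀ {x y i j} → x ≤ i → y ≤ j → (S x y → S i j) → f x y ≤ f i j

    row₀ : ∀ {j} → f 0 j ≡ 0
    row₀ = off λ s → contradiction (S-row s) λ ()

    col₀ : ∀ {i} → f i 0 ≡ 0
    col₀ = off λ s → contradiction (S-col s) λ ()

  isFilling-stepwise : ∀ {f : ℕ → ℕ → ℕ} → (∀ {i j} → ¬ S i j → f i j ≡ 0) →
    (∀ {i j} → S i j → S i (suc j) → f i j ≤ f i (suc j)) →
    (∀ {i j} → S i j → S (suc i) j → f i j ≤ f (suc i) j) → IsFilling f
  isFilling-stepwise {f} off right up = record { off = off ; mono = mono }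
    where
    rightward : ∀ {x y j} → 1 ≤ y → y ≤′ j → S x j → f x y ≤ f x j
    rightward 1≤y ≤′-refl       s = ≤-refl
    rightward 1≤y (≤′-step y≤j) s = ≤-trans (rightward 1≤y y≤j s′) (right s′ s)
      where s′ = S-down (S-row s) (≤-trans 1≤y (≤′⇒≤ y≤j)) ≤-refl (n≤1+n _) s
    upward : ∀ {x i j} → 1 ≤ x → x ≤′ i → S i j → f x j ≤ f i j
    upward 1≤x ≤′-refl       s = ≤-refl
    upward 1≤x (≤′-step x≤i) s = ≤-trans (upward 1≤x x≤i s′) (up s′ s)
      where s′ = S-down (≤-trans 1≤x (≤′⇒≤ x≤i)) (S-col s) (n≤1+n _) ≤-refl s
    mono : ∀ {x y i j} → x ≤ i → y ≤ j → (S x y → S i j) → f x y ≤ f i j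
    mono {x} {y} x≤i y≤j imp with inShape? μ x y
    ... | no ¬p = ≤-trans (≤-reflexive (off ¬p)) z≤n
    -- The path goes right to the corner `(x , j)`, which lies in the shape below `(i , j)`, and
    -- then upwards.
    ... | yes p = ≤-trans (rightward (S-col p) (≤⇒≤′ y≤j) (S-down (S-row p) (S-col (imp p)) x≤i ≤-refl (imp p)))
                          (upward (S-row p) (≤⇒≤′ x≤i) (imp p))

  depth-tail : ∀ {i j e} → S i j → 2 + e ≤ depth i j → suc e ≤ depth (suc i) (suc j)
  depth-tail s le = ≤-pred (≤-trans le (≤-reflexive (depth-suc s)))

  paint : (b r : ℕ → ℕ → ℕ) → Colour × ℕ × ℕ → ℕ
  paint b r (blue , i , j) = b i j
  paint b r (red  , i , j) = r i j

  -- Partial inverse of `source`: an entry at depth `d` moves `d - bit c` cells inwards, to depth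
  -- `2d - bit c`. If this leaves the shape, truncated subtraction gives row or column 0, where
  -- every filling vanishes.
  target : Colour × ℕ × ℕ → ℕ × ℕ
  target (c , i , j) = i ∸ (depth i j ∸ bit c) , j ∸ (depth i j ∸ bit c)

  -- On a diagonal the entries of merge b r are, from the outermost cell inwards, the
  -- outermost entry of r, that of b, the next entry of r, the next entry of b, and so on.
  merge : (b r : ℕ → ℕ → ℕ) → ℕ → ℕ → ℕ
  merge b r i j = paint b r (source (depth i j) i j)

  split : (ℕ → ℕ → ℕ) → Colour → ℕ → ℕ → ℕ
  split p c i j = p (i ∸ (depth i j ∸ bit c)) (j ∸ (depth i j ∸ bit c))

  source-S : ∀ {i j} → S i j → ∃₂ λ c k →
    source (depth i j) i j ≡ (c , k + i , k + j) × S (k + i) (k + j) × depth (k + i) (k + j) ≡ bit c + k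
  source-S {i} {j} s with halve (depth i j)
  ... | c , k , eq = c , k , trans (cong (λ e → source e i j) eq) (source-double c k i j) , s′ ,
      +-cancelˡ-≡ k _ _ (trans (sym (depth-+ k (S-row s) (S-col s) s′)) (trans eq (x∙yz≈y∙xz (bit c) k k)))
    where
    -- Depth 0, the only case in which the cell `k` steps out could be missing, is excluded because
    -- `(i , j)` lies in the shape.
    k< : ∀ c k → 0 < bit c + (k + k) → k < bit c + (k + k)
    k< red  k       _ = s≤s (m≤m+n k k)
    k< blue (suc k) _ = m<m+n (suc k) (s≤s z≤n)
    s′ : S (k + i) (k + j)
    s′ = <depth⇒S k (subst (k <_) (sym eq) (k< c k (subst (0 <_) eq (S⇒0<depth s))))

  target-source : ∀ {i j} → S i j → target (source (depth i j) i j) ≡ (i , j)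
  target-source {i} {j} s with source-S s
  ... | c , k , eq , _ , d rewrite eq | d | m+n∸m≡n (bit c) k | m+n∸m≡n k i | m+n∸m≡n k j = refl

  merge-split : ∀ p {i j} → S i j → merge (split p blue) (split p red) i j ≡ p i j
  merge-split p {i} {j} s = trans (lemma (source (depth i j) i j)) (cong (λ (x , y) → p x y) (target-source s))
    where
    lemma : ∀ t → paint (split p blue) (split p red) t ≡ p (proj₁ (target t)) (proj₂ (target t))
    lemma (blue , _) = refl
    lemma (red  , _) = refl

  source-target : ∀ c {i j} → S i j → let (x , y) = target (c , i , j) in S x y → source (depth x y) x y ≡ (c , i , j)
  source-target c {i} {j} s s′ = begin
    source (depth x y) x y        ≡⟨ cong (λ e → source e x y) d ⟩
    source (bit c + (k + k)) x y  ≡⟨ source-double c k x y ⟩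
    (c , k + x , k + y)           ≡⟨ cong₂ (λ x y → c , x , y) kx ky ⟩
    (c , i , j)                   ∎
    where
    open ≡-Reasoning
    k x y : ℕ
    k = depth i j ∸ bit c
    x = i ∸ k
    y = j ∸ k
    bit≤1 : ∀ c → bit c ≤ 1
    bit≤1 blue = z≤n
    bit≤1 red  = ≤-refl
    -- Since `(x , y)` lies in the shape, its coordinates are positive, so the subtractions were not
    -- truncated.
    kx : k + x ≡ i
    kx = m+[n∸m]≡n (<⇒≤ (m∸n≢0⇒n<m {i} {k} (>⇒≢ (S-row s′))))
    ky : k + y ≡ j
    ky = m+[n∸m]≡n (<⇒≤ (m∸n≢0⇒n<m {j} {k} (>⇒≢ (S-col s′))))
    d : depth x y ≡ bit c + (k + k)
    d = begin
      depth x y                  ≡⟨ depth-+ k (S-row s′) (S-col s′) (subst₂ S (sym kx) (sym ky) s) ⟩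
      k + depth (k + x) (k + y)  ≡⟨ cong₂ (λ x y → k + depth x y) kx ky ⟩
      k + depth i j              ≡⟨ cong (k +_) (sym (m+[n∸m]≡n (≤-trans (bit≤1 c) (S⇒0<depth s)))) ⟩
      k + (bit c + k)            ≡⟨ x∙yz≈y∙xz k (bit c) k ⟩
      bit c + (k + k)            ∎

  off-target : ∀ {i j k} → ¬ S (i ∸ k) (j ∸ k) → S i j → i ≤ k ⊎ j ≤ k
  off-target {i} {j} {k} ¬p s with i ≤? k | j ≤? k
  ... | yes i≤k | _       = inj₁ i≤k
  ... | no  _   | yes j≤k = inj₂ j≤k
  ... | no  i≰k | no  j≰k = contradiction
    (S-down (m<n⇒0<n∸m (≰⇒> i≰k)) (m<n⇒0<n∸m (≰⇒> j≰k)) (m∸n≤m i k) (m∸n≤m j k) s) ¬p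

  -- In a hole slice a red left face and the red top face above it together occupy
  -- ⟨ r k l , suc (r k (suc l)) ]; in a particle slice a blue right face is taken together
  -- with the blue top face below it.
  record Uncoupled (b r : ℕ → ℕ → ℕ) : Set where
    field
      hole-free : ∀ {i j k l h h′} → Hole i j → S i (suc j) → S k (suc l) → j + k ≡ l + i →
        b i j < h → h ≤ b i (suc j) → r k l < h′ → h′ ≤ suc (r k (suc l)) → h + i ≢ h′ + k
      particle-free : ∀ {i j k l h h′} → Particle i j → S (suc i) (suc j) → S (suc k) (suc l) → j + k ≡ l + i →
        r i (suc j) < h → h ≤ r (suc i) (suc j) → b k (suc l) ≤ h′ → h′ ≤ b (suc k) (suc l) → h + i ≢ h′ + k

  -- From an uncoupled pair to a merged filling

  module Interlacing {b r} (bF : IsFilling b) (rF : IsFilling r) (un : Uncoupled b r) where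
    private
      module b = IsFilling bF
      module r = IsFilling rF
    open Uncoupled un

    -- Otherwise `suc (r i j)`, the lowest height of the red interval in row `i`, also belongs to
    -- the blue left faces there.
    hole-b≤r-step : ∀ {i j} → Hole i j → S i (suc j) → b i j ≤ r i j → b i (suc j) ≤ r i j
    hole-b≤r-step H s b≤r = ≮⇒≥ λ r<b →
      hole-free H s s refl (s≤s b≤r) r<b ≤-refl (s≤s (r.mono ≤-refl (n≤1+n _) λ _ → s)) refl

    -- Otherwise the height `b (suc i) (suc j)` belongs to both the blue and the red interval at
    -- this cell.
    particle-b≤r-step : ∀ {i j} → Particle i j → S (suc i) (suc j) → b (suc i) (suc j) ≤ r (suc i) (suc j) →
      b (suc i) (suc j) ≤ r i (suc j)
    particle-b≤r-step P s b≤r = ≮⇒≥ λ r<b →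
      particle-free P s s refl r<b b≤r (b.mono (n≤1+n _) ≤-refl λ _ → s) ≤-refl refl

    -- Otherwise there is a blue left face at height `r i (suc j)` in row `suc i`. The red top face
    -- of `(i , suc j)` is recorded one unit higher but one row lower, so the two coincide.
    hole-r≤b-step : ∀ {i j} → 1 ≤ i → Hole i j → S (suc i) (suc j) → r i (suc j) ≤ b (suc i) (2 + j) →
      r i (suc j) ≤ b (suc i) (suc j)
    hole-r≤b-step {i} {j} 1≤i H s r≤b = ≮⇒≥ λ b<r →
      hole-free (Hole-suc H) (Hole⇒S-right (Hole-suc H) s) s′ (sym (+-suc j i))
        b<r r≤b (s≤s (r.mono ≤-refl (n≤1+n _) λ _ → s′)) ≤-refl (+-suc _ i)
      where
      s′ : S i (suc j)
      s′ = S-down 1≤i (s≤s z≤n) (n≤1+n _) ≤-refl s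

    -- Otherwise the red right face at height `suc (b (suc i) (2 + j))` at `(suc i , suc j)`
    -- coincides with the blue top face of `(suc i , 2 + j)`.
    particle-r≤b-step : ∀ {i j} → Particle (suc i) (suc j) → S (2 + i) (2 + j) → r i (suc j) ≤ b (suc i) (2 + j) →
      r (suc i) (suc j) ≤ b (suc i) (2 + j)
    particle-r≤b-step {i} {j} P s r≤b = ≮⇒≥ λ b<r →
      particle-free (Particle-pred P) (S-pred (s≤s z≤n) (s≤s z≤n) s) s (+-suc j i)
        (s≤s r≤b) b<r ≤-refl (b.mono (n≤1+n _) ≤-refl λ _ → s) (sym (+-suc _ i))

    -- Induction over the diagonals from left to right, with `n` bounding the distance of the
    -- diagonal from the left end. Each slice is crossed by the step lemma of its kind and
    -- monotonicity of one filling.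
    b≤r-fuelled : ∀ n {i j} → S i j → j + ℓ μ ≤ n + i → b i j ≤ r i j
    b≤r-fuelled zero {i} {j} s le = ⊥-elim (left-bound s le)
    b≤r-fuelled (suc n) {i} {zero} s le = contradiction (S-col s) λ ()
    b≤r-fuelled (suc n) {i} {suc j} s (s≤s le) with slice-left s
    ... | inj₁ H = ≤-trans (hole-b≤r-step H s left) (r.mono ≤-refl (n≤1+n _) λ _ → s)
      where
      left : b i j ≤ r i j
      left with inShape? μ i j
      ... | yes p = b≤r-fuelled n p le
      ... | no ¬p = ≤-trans (≤-reflexive (b.off ¬p)) z≤n
    ... | inj₂ P = ≤-trans (b.mono (n≤1+n _) ≤-refl λ _ → up) (particle-b≤r-step P up
        (b≤r-fuelled n up (≤-trans (s≤s le) (≤-reflexive (sym (+-suc n i))))))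
      where
      up : S (suc i) (suc j)
      up = Particle⇒S-up P s

    b≤r : ∀ {i j} → S i j → b i j ≤ r i j
    b≤r {i} {j} s = b≤r-fuelled (j + ℓ μ) s (m≤m+n _ i)

    -- The mirror image of the previous induction: it starts at the right end and carries the other
    -- inequality leftwards.
    r≤b-fuelled : ∀ n {i j} → S (suc i) (suc j) → part μ 1 + i ≤ n + j → r i j ≤ b (suc i) (suc j)
    r≤b-fuelled zero s le = ⊥-elim (right-bound s (≤-trans (≤-reflexive (+-suc _ _)) (s≤s le)))
    r≤b-fuelled (suc n) {zero} s le = ≤-trans (≤-reflexive r.row₀) z≤n
    r≤b-fuelled (suc n) {suc i} {zero} s le = ≤-trans (≤-reflexive r.col₀) z≤n
    r≤b-fuelled (suc n) {suc i} {suc j} s le with slice-right s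
    ... | inj₂ P = ≤-trans
      (particle-r≤b-step (Particle-pred P) s (r≤b-fuelled n (S-down (s≤s z≤n) (s≤s z≤n) (n≤1+n _) ≤-refl s)
        (≤-pred (≤-trans (≤-reflexive (sym (+-suc _ i))) le))))
      (b.mono (n≤1+n _) ≤-refl λ _ → s)
    ... | inj₁ H = ≤-trans
      (r.mono ≤-refl (n≤1+n _) λ _ → S-down (s≤s z≤n) (s≤s z≤n) (n≤1+n _) ≤-refl s)
      (hole-r≤b-step (s≤s z≤n) (Hole-pred H) s
        (r≤b-fuelled n (Hole⇒S-right H s) (≤-trans le (≤-reflexive (sym (+-suc n (suc j)))))))

    r≤b : ∀ {i j} → S (suc i) (suc j) → r i j ≤ b (suc i) (suc j)
    r≤b {i} {j} s = r≤b-fuelled (part μ 1 + i) s (m≤m+n _ j)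

    hole-b≤r : ∀ {i j} → Hole i j → S i (suc j) → b i (suc j) ≤ r i j
    hole-b≤r {i} {j} H s = hole-b≤r-step H s left
      where
      left : b i j ≤ r i j
      left with inShape? μ i j
      ... | yes p = b≤r p
      ... | no ¬p = ≤-trans (≤-reflexive (b.off ¬p)) z≤n

    particle-b≤r : ∀ {i j} → Particle i j → S (suc i) (suc j) → b (suc i) (suc j) ≤ r i (suc j)
    particle-b≤r P s = particle-b≤r-step P s (b≤r s)

    hole-r≤b : ∀ {i j} → Hole i j → S (suc i) (suc j) → r i (suc j) ≤ b (suc i) (suc j)
    hole-r≤b {zero}  H s = ≤-trans (≤-reflexive r.row₀) z≤n
    hole-r≤b {suc i} H s = hole-r≤b-step (s≤s z≤n) H s (r≤b (Hole⇒S-right (Hole-suc H) s))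

    particle-r≤b : ∀ {i j} → Particle i j → S (suc i) (suc j) → r i j ≤ b i (suc j)
    particle-r≤b {zero}          P s = ≤-trans (≤-reflexive r.row₀) z≤n
    particle-r≤b {suc i} {zero}  P s = ≤-trans (≤-reflexive r.col₀) z≤n
    particle-r≤b {suc i} {suc j} P s =
      particle-r≤b-step P s (r≤b (S-down (s≤s z≤n) (s≤s z≤n) (n≤1+n _) ≤-refl s))

    mutual
      -- These are the entries that `target` would push to column 0. Each is bounded by an entry one
      -- diagonal further left: within a colour column and depth stay the same, from blue to red the
      -- column drops by one, from red to blue the depth does. The descent ends at column 0.
      b-col-zero : ∀ n {i j} → S i j → j + ℓ μ ≤ n + i → j ≤ depth i j → b i j ≡ 0
      b-col-zero zero {i} {j} s le d = ⊥-elim (left-bound s le)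
      b-col-zero (suc n) {i} {zero} s le d = b.col₀
      b-col-zero (suc n) {i} {suc j} s (s≤s le) d with slice-left s
      ... | inj₂ P = ≤∧≡0⇒≡0 (b.mono (n≤1+n _) ≤-refl λ _ → up)
          (b-col-zero n up (≤-trans (s≤s le) (≤-reflexive (sym (+-suc n i))))
            (≤-trans d (≤-reflexive (sym (Particle⇒depth-up (S-row s) P)))))
        where
        up : S (suc i) (suc j)
        up = Particle⇒S-up P s
      b-col-zero (suc n) {i} {suc zero}    s (s≤s le) d | inj₁ H = ≤∧≡0⇒≡0 (hole-b≤r H s) r.col₀
      b-col-zero (suc n) {i} {suc (suc j)} s (s≤s le) d | inj₁ H = ≤∧≡0⇒≡0 (hole-b≤r H s)
        (r-col-zero n (S-down (S-row s) (s≤s z≤n) ≤-refl (n≤1+n _) s) le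
          (≤-trans d (≤-reflexive (Hole⇒depth-right (S-row s) (s≤s z≤n) H))))

      r-col-zero : ∀ n {i j} → S i j → j + ℓ μ ≤ n + i → j < depth i j → r i j ≡ 0
      r-col-zero zero {i} {j} s le d = ⊥-elim (left-bound s le)
      r-col-zero (suc n) {i} {zero} s le d = r.col₀
      r-col-zero (suc n) {i} {suc j} s (s≤s le) d with slice-left s
      ... | inj₂ P = ≤∧≡0⇒≡0 (r.mono (n≤1+n _) ≤-refl λ _ → up)
          (r-col-zero n up (≤-trans (s≤s le) (≤-reflexive (sym (+-suc n i))))
            (≤-trans d (≤-reflexive (sym (Particle⇒depth-up (S-row s) P)))))
        where
        up : S (suc i) (suc j)
        up = Particle⇒S-up P s
      ... | inj₁ H = ≤∧≡0⇒≡0 (hole-r≤b H up)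
          (b-col-zero n up (≤-trans (s≤s le) (≤-reflexive (sym (+-suc n i))))
            (≤-pred (≤-trans d (≤-reflexive (Hole⇒depth-up s H)))))
        where
        up : S (suc i) (suc j)
        up = S-down (s≤s z≤n) (s≤s z≤n) ≤-refl (n≤1+n _) (1<depth⇒S (≤-trans (s≤s (s≤s z≤n)) d))

    mutual
      -- The same descent with rows in place of columns, moving to the right until row 0 is reached.
      b-row-zero : ∀ n {i j} → S i j → part μ 1 + i ≤ n + j → i ≤ depth i j → b i j ≡ 0
      b-row-zero n {zero} s le d = b.row₀
      b-row-zero n {i} {zero} s le d = b.col₀
      b-row-zero zero {suc i} {suc j} s le d = ⊥-elim (right-bound s le)
      b-row-zero (suc n) {suc i} {suc j} s le d with slice-right s
      ... | inj₁ H = ≤∧≡0⇒≡0 (b.mono ≤-refl (n≤1+n _) λ _ → right)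
          (b-row-zero n right (≤-trans le (≤-reflexive (sym (+-suc n _))))
            (≤-trans d (≤-reflexive (sym (Hole⇒depth-right (s≤s z≤n) (s≤s z≤n) H)))))
        where
        right : S (suc i) (2 + j)
        right = Hole⇒S-right H s
      b-row-zero (suc n) {suc zero}    {suc j} s le d | inj₂ P =
        ≤∧≡0⇒≡0 (particle-b≤r (Particle-pred P) s) r.row₀
      b-row-zero (suc n) {suc (suc i)} {suc j} s le d | inj₂ P =
        ≤∧≡0⇒≡0 (particle-b≤r (Particle-pred P) s)
          (r-row-zero n (S-down (s≤s z≤n) (s≤s z≤n) (n≤1+n _) ≤-refl s)
            (≤-pred (≤-trans (≤-reflexive (sym (+-suc _ (suc i)))) le))
            (≤-trans d (≤-reflexive (Particle⇒depth-up (s≤s z≤n) (Particle-pred P)))))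

      r-row-zero : ∀ n {i j} → S i j → part μ 1 + i ≤ n + j → i < depth i j → r i j ≡ 0
      r-row-zero n {zero} s le d = r.row₀
      r-row-zero n {i} {zero} s le d = r.col₀
      r-row-zero zero {suc i} {suc j} s le d = ⊥-elim (right-bound s le)
      r-row-zero (suc n) {suc i} {suc j} s le d with slice-right s
      ... | inj₁ H = ≤∧≡0⇒≡0 (r.mono ≤-refl (n≤1+n _) λ _ → right)
          (r-row-zero n right (≤-trans le (≤-reflexive (sym (+-suc n _))))
            (≤-trans d (≤-reflexive (sym (Hole⇒depth-right (s≤s z≤n) (s≤s z≤n) H)))))
        where
        right : S (suc i) (2 + j)
        right = Hole⇒S-right H s
      ... | inj₂ P = ≤∧≡0⇒≡0 (particle-r≤b P upright)
          (b-row-zero n (S-down (s≤s z≤n) (s≤s z≤n) (n≤1+n _) ≤-refl upright) (≤-trans le (≤-reflexive (sym (+-suc n _))))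
            (≤-pred (≤-trans d (≤-reflexive (Particle⇒depth-right s P)))))
        where
        upright : S (2 + i) (2 + j)
        upright = 1<depth⇒S (≤-trans (s≤s (s≤s z≤n)) d)

    b-zero : ∀ {i j} → S i j → i ≤ depth i j ⊎ j ≤ depth i j → b i j ≡ 0
    b-zero {i} {j} s (inj₁ d) = b-row-zero (part μ 1 + i) s (m≤m+n _ j) d
    b-zero {i} {j} s (inj₂ d) = b-col-zero (j + ℓ μ) s (m≤m+n _ i) d

    r-zero : ∀ {i j} → S i j → i < depth i j ⊎ j < depth i j → r i j ≡ 0
    r-zero {i} {j} s (inj₁ d) = r-row-zero (part μ 1 + i) s (m≤m+n _ j) d
    r-zero {i} {j} s (inj₂ d) = r-col-zero (j + ℓ μ) s (m≤m+n _ i) d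

    -- At `e = depth i j` this is `merge b r i j`. Freeing the index allows induction outwards along
    -- the diagonal, two units of `e` at a time.
    pick : ℕ → ℕ → ℕ → ℕ
    pick e i j = paint b r (source e i j)

    pick-mono : ∀ e {x y i j} → x ≤ i → y ≤ j → S i j → e ≤ depth i j → pick e x y ≤ pick e i j
    pick-mono 0             x≤i y≤j s le = b.mono x≤i y≤j λ _ → s
    pick-mono 1             x≤i y≤j s le = r.mono x≤i y≤j λ _ → s
    pick-mono (suc (suc e)) x≤i y≤j s le =
      pick-mono e (s≤s x≤i) (s≤s y≤j) (1<depth⇒S (≤-trans (s≤s (s≤s z≤n)) le)) (<⇒≤ (depth-tail s le))

    -- A step to the right across a particle slice lowers the depth by one and so swaps the colours;
    -- the base cases are the two interlacing inequalities of such a slice.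
    particle-pick : ∀ e {i j} → Particle i j → S i (suc j) → e ≤ depth i (suc j) → pick (suc e) i j ≤ pick e i (suc j)
    particle-pick 0             P s le = particle-r≤b P (Particle⇒S-up P s)
    particle-pick 1             P s le = particle-b≤r P (Particle⇒S-up P s)
    particle-pick (suc (suc e)) P s le =
      particle-pick e (Particle-suc P) (1<depth⇒S (≤-trans (s≤s (s≤s z≤n)) le)) (<⇒≤ (depth-tail s le))

    -- The colours are likewise swapped by a step upwards from the right diagonal of a hole slice.
    hole-pick : ∀ e {i j} → Hole i j → S (suc i) (suc j) → e ≤ depth (suc i) (suc j) → pick (suc e) i (suc j) ≤ pick e (suc i) (suc j)
    hole-pick 0             H s le = hole-r≤b H s
    hole-pick 1             H s le = hole-b≤r (Hole-suc H) (Hole⇒S-right (Hole-suc H) s)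
    hole-pick (suc (suc e)) H s le =
      hole-pick e (Hole-suc H) (1<depth⇒S (≤-trans (s≤s (s≤s z≤n)) le)) (<⇒≤ (depth-tail s le))

    merge-off : ∀ {i j} → ¬ S i j → merge b r i j ≡ 0
    merge-off ¬s rewrite depth-off ¬s = b.off ¬s

    merge-right : ∀ {i j} → S i j → S i (suc j) → merge b r i j ≤ merge b r i (suc j)
    merge-right {i} {j} s₀ s with slice-left s
    ... | inj₁ H rewrite Hole⇒depth-right (S-row s) (S-col s₀) H =
      pick-mono (depth i j) ≤-refl (n≤1+n _) s (≤-reflexive (sym (Hole⇒depth-right (S-row s) (S-col s₀) H)))
    ... | inj₂ P rewrite Particle⇒depth-right s₀ P = particle-pick (depth i (suc j)) P s ≤-refl

    merge-up : ∀ {i j} → S i j → S (suc i) j → merge b r i j ≤ merge b r (suc i) j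
    merge-up {i} {zero}  s₀ s = contradiction (S-col s) λ ()
    merge-up {i} {suc j} s₀ s with slice-left s₀
    ... | inj₁ H rewrite Hole⇒depth-up s₀ H = hole-pick (depth (suc i) (suc j)) H s ≤-refl
    ... | inj₂ P rewrite sym (Particle⇒depth-up (S-row s₀) P) = pick-mono (depth (suc i) (suc j)) (n≤1+n _) ≤-refl s ≤-refl

    merge-isFilling : IsFilling (merge b r)
    merge-isFilling = isFilling-stepwise merge-off merge-right merge-up

    split-merge-blue : ∀ {i j} → S i j → split (merge b r) blue i j ≡ b i j
    split-merge-blue {i} {j} s with inShape? μ (i ∸ depth i j) (j ∸ depth i j)
    ... | yes p = cong (paint b r) (source-target blue s p)
    -- No merged entry comes from this coloured cell, so nothing may be lost: its own entry has to
    -- be 0.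
    ... | no ¬p = trans (merge-off ¬p) (sym (b-zero s (off-target ¬p s)))

    split-merge-red : ∀ {i j} → S i j → split (merge b r) red i j ≡ r i j
    split-merge-red {i} {j} s with inShape? μ (i ∸ (depth i j ∸ 1)) (j ∸ (depth i j ∸ 1))
    ... | yes p = cong (paint b r) (source-target red s p)
    ... | no ¬p = trans (merge-off ¬p) (sym (r-zero s (Sum.map below below (off-target ¬p s))))
      where
      below : ∀ {x} → x ≤ depth i j ∸ 1 → x < depth i j
      below le = ≤-trans (s≤s le) (≤-reflexive (m+[n∸m]≡n (S⇒0<depth s)))

  -- From a filling to an uncoupled pair

  Hole-diagonal : ∀ {i j k l} → j + k ≡ l + i → Hole i j → Hole k l
  Hole-diagonal {i} {j} {k} {l} eq (hole {I} {J} p q e) = hole p q (diagonal-shift J (suc j) (suc l) (cong suc eq) e)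

  Particle-diagonal : ∀ {i j k l} → j + k ≡ l + i → Particle i j → Particle k l
  Particle-diagonal {i} {j} {k} {l} eq (particle {I} {J} p q e) = particle p q (diagonal-shift J j l eq e)

  module Splitting {p} (pF : IsFilling p) where
    private module p = IsFilling pF

    b r : ℕ → ℕ → ℕ
    b = split p blue
    r = split p red

    mono-∸ : ∀ m n {x y i j} → x ≤ i ∸ m → y ≤ j ∸ n → S i j → p x y ≤ p (i ∸ m) (j ∸ n)
    mono-∸ m n {i = i} {j} x≤ y≤ s =
      p.mono x≤ y≤ λ s′ → S-down (≤-trans (S-row s′) x≤) (≤-trans (S-col s′) y≤) (m∸n≤m i m) (m∸n≤m j n) s

    split-isFilling : ∀ c → IsFilling (split p c)
    split-isFilling c = record { off = off ; mono = mono }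
      where
      off : ∀ {i j} → ¬ S i j → split p c i j ≡ 0
      off ¬s rewrite depth-off ¬s | 0∸n≡0 (bit c) = p.off ¬s
      mono : ∀ {x y i j} → x ≤ i → y ≤ j → (S x y → S i j) → split p c x y ≤ split p c i j
      mono {x} {y} {i} {j} x≤i y≤j imp with inShape? μ x y
      ... | no ¬s = ≤-trans (≤-reflexive (off ¬s)) z≤n
      ... | yes s = mono-∸ (depth i j ∸ bit c) (depth i j ∸ bit c) (∸-mono x≤i d≤) (∸-mono y≤j d≤) (imp s)
        where
        d≤ : depth i j ∸ bit c ≤ depth x y ∸ bit c
        d≤ = ∸-monoˡ-≤ (bit c) (depth-antitone (S-row s) (S-col s) x≤i y≤j)

    -- This and the next three lemmas express the entries on both sides of a slice through the depth
    -- at one common cell. In column or row 0 the depths may differ, but both sides vanish.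
    hole-b : ∀ {i j} → S i (suc j) → Hole i j → b i j ≡ p (i ∸ depth i (suc j)) (j ∸ depth i (suc j))
    hole-b {i} {zero}  s H = trans (IsFilling.col₀ (split-isFilling blue)) (sym (trans (cong (p _) (0∸n≡0 (depth i 1))) p.col₀))
    hole-b {i} {suc j} s H rewrite Hole⇒depth-right (S-row s) (s≤s z≤n) H = refl

    hole-r : ∀ {i j} → S i (suc j) → Hole i j → r i j ≡ p (i ∸ (depth i (suc j) ∸ 1)) (j ∸ (depth i (suc j) ∸ 1))
    hole-r {i} {zero}  s H = trans (IsFilling.col₀ (split-isFilling red)) (sym (trans (cong (p _) (0∸n≡0 (depth i 1 ∸ 1))) p.col₀))
    hole-r {i} {suc j} s H rewrite Hole⇒depth-right (S-row s) (s≤s z≤n) H = refl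

    particle-b : ∀ {i j} → S (suc i) (suc j) → Particle i j →
      b i (suc j) ≡ p (i ∸ depth (suc i) (suc j)) (suc j ∸ depth (suc i) (suc j))
    particle-b {zero}  {j} s P = trans (IsFilling.row₀ (split-isFilling blue))
      (sym (trans (cong (λ x → p x (suc j ∸ depth 1 (suc j))) (0∸n≡0 (depth 1 (suc j)))) p.row₀))
    particle-b {suc i} {j} s P rewrite Particle⇒depth-up (s≤s z≤n) P = refl

    particle-r : ∀ {i j} → S (suc i) (suc j) → Particle i j →
      r i (suc j) ≡ p (i ∸ (depth (suc i) (suc j) ∸ 1)) (suc j ∸ (depth (suc i) (suc j) ∸ 1))
    particle-r {zero}  {j} s P = trans (IsFilling.row₀ (split-isFilling red))
      (sym (trans (cong (λ x → p x (suc j ∸ (depth 1 (suc j) ∸ 1))) (0∸n≡0 (depth 1 (suc j) ∸ 1))) p.row₀))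
    particle-r {suc i} {j} s P rewrite Particle⇒depth-up (s≤s z≤n) P = refl

    depth-drop : ∀ {i j x y} → S x y → x < i → y < j → depth i j ≤ depth x y ∸ 1
    depth-drop s x<i y<j = ≤-trans (depth-antitone (s≤s z≤n) (s≤s z≤n) x<i y<j) (∸-monoˡ-≤ 1 (≤-reflexive (sym (depth-suc s))))

    -- Comparing the two rows orders the heights in the same direction. In a hole slice `i ≤ k`
    -- forces `h < h′` and `k < i` forces `h′ ≤ h`; in a particle slice `k ≤ i` forces `h′ < h` and
    -- `i < k` forces `h ≤ h′`. So the sums of height and row differ.
    split-uncoupled : Uncoupled b r
    split-uncoupled = record { hole-free = hole-free ; particle-free = particle-free }
      where
      hole-free : ∀ {i j k l h h′} → Hole i j → S i (suc j) → S k (suc l) → j + k ≡ l + i →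
        b i j < h → h ≤ b i (suc j) → r k l < h′ → h′ ≤ suc (r k (suc l)) → h + i ≢ h′ + k
      hole-free {i} {j} {k} {l} {h} {h′} H s t eq b< ≤b r< ≤r with i ≤? k
      ... | yes i≤k = <⇒≢ (+-mono-<-≤ (≤-trans (s≤s (≤-trans ≤b b≤r)) r<) i≤k)
        where
        j≤l : j ≤ l
        j≤l = +-≡∧≤⇒≥ l j (sym eq) i≤k
        d≤ : depth k (suc l) ≤ depth i (suc j)
        d≤ = depth-antitone (S-row s) (s≤s z≤n) i≤k (s≤s j≤l)
        b≤r : b i (suc j) ≤ r k l
        b≤r = ≤-trans
          (mono-∸ (depth k (suc l) ∸ 1) (depth k (suc l)) (∸-mono i≤k (≤-trans (m∸n≤m _ 1) d≤)) (∸-mono (s≤s j≤l) d≤) t)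
          (≤-reflexive (trans (cong (p (k ∸ (depth k (suc l) ∸ 1))) (suc-∸ l (S⇒0<depth t))) (sym (hole-r t (Hole-diagonal eq H)))))
      ... | no i≰k = λ e → <⇒≢ (+-mono-≤-< (≤-trans ≤r (≤-trans (s≤s r≤b) b<)) k<i) (sym e)
        where
        k<i : k < i
        k<i = ≰⇒> i≰k
        l<j : l < j
        l<j = +-≡∧≤⇒≥ j (suc l) (trans (+-suc j k) (cong suc eq)) k<i
        d≤ : depth i (suc j) ≤ depth k (suc l) ∸ 1
        d≤ = depth-drop t k<i (s≤s l<j)
        r≤b : r k (suc l) ≤ b i j
        r≤b = ≤-trans
          (mono-∸ (depth i (suc j)) (depth i (suc j)) (∸-mono (<⇒≤ k<i) d≤) (∸-mono l<j d≤)
            (S-down (S-row s) (≤-trans (s≤s z≤n) l<j) ≤-refl (n≤1+n j) s))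
          (≤-reflexive (sym (hole-b s H)))

      particle-free : ∀ {i j k l h h′} → Particle i j → S (suc i) (suc j) → S (suc k) (suc l) → j + k ≡ l + i →
        r i (suc j) < h → h ≤ r (suc i) (suc j) → b k (suc l) ≤ h′ → h′ ≤ b (suc k) (suc l) → h + i ≢ h′ + k
      particle-free {i} {j} {k} {l} {h} {h′} P s t eq r< ≤r b≤ ≤b with k ≤? i
      ... | yes k≤i = λ e → <⇒≢ (+-mono-<-≤ (≤-trans (s≤s (≤-trans ≤b b≤r)) r<) k≤i) (sym e)
        where
        l≤j : l ≤ j
        l≤j = +-≡∧≤⇒≥ j l eq k≤i
        d≤ : depth (suc i) (suc j) ≤ depth (suc k) (suc l)
        d≤ = depth-antitone (s≤s z≤n) (s≤s z≤n) (s≤s k≤i) (s≤s l≤j)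
        b≤r : b (suc k) (suc l) ≤ r i (suc j)
        b≤r = ≤-trans
          (mono-∸ (depth (suc i) (suc j)) (depth (suc i) (suc j) ∸ 1) (∸-mono (s≤s k≤i) d≤) (∸-mono (s≤s l≤j) (≤-trans (m∸n≤m _ 1) d≤)) s)
          (≤-reflexive (trans (cong (λ x → p x (suc j ∸ (depth (suc i) (suc j) ∸ 1))) (suc-∸ i (S⇒0<depth s))) (sym (particle-r s P))))
      ... | no k≰i = <⇒≢ (+-mono-≤-< (≤-trans ≤r (≤-trans r≤b b≤)) i<k)
        where
        i<k : i < k
        i<k = ≰⇒> k≰i
        j<l : j < l
        j<l = +-≡∧≤⇒≥ l (suc j) (trans (+-suc l i) (cong suc (sym eq))) i<k
        d≤ : depth (suc k) (suc l) ≤ depth (suc i) (suc j) ∸ 1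
        d≤ = depth-drop s (s≤s i<k) (s≤s j<l)
        r≤b : r (suc i) (suc j) ≤ b k (suc l)
        r≤b = ≤-trans
          (mono-∸ (depth (suc k) (suc l)) (depth (suc k) (suc l)) (∸-mono i<k d≤) (∸-mono (<⇒≤ (s≤s j<l)) d≤)
            (S-down (≤-trans (s≤s z≤n) i<k) (s≤s z≤n) (n≤1+n k) ≤-refl t))
          (≤-reflexive (sym (particle-b t (Particle-diagonal eq P))))

  -- Coupled pairs of reverse plane partitions

  ∈cells⁺ : ∀ {i j} → S i j → (i , j) ∈ cells μ
  ∈cells⁺ {i} s = ∈-concatMap⁺ (λ i → map (i ,_) ⟨ 0 , part μ i ]) {xs = ⟨ 0 , ℓ μ ]}
    (lose (∈⟨]⁺ (S-row s) (S-row≤ℓ s)) (∈-map⁺ (i ,_) (∈⟨]⁺ (S-col s) (S-col≤part s))))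

  ∈cells⁻ : ∀ {i j} → (i , j) ∈ cells μ → S i j
  ∈cells⁻ c with find (∈-concatMap⁻ (λ i → map (i ,_) ⟨ 0 , part μ i ]) {xs = ⟨ 0 , ℓ μ ]} c)
  ... | i , i∈ , p with ∈-map⁻ (i ,_) p
  ...   | j , j∈ , refl = ∈⟨]⁻ i∈ , ∈⟨]⁻ j∈

  cells-unique : Unique (cells μ)
  cells-unique = Unique.concat⁺
    (All.map⁺ (All.tabulate λ {i} _ → Unique.map⁺ (cong proj₂) (⟨]-unique 0 (part μ i))))
    (AllPairs.map⁺ (AllPairs.map disjoint (⟨]-unique 0 (ℓ μ))))
    where
    disjoint : ∀ {i k} → i ≢ k → ∀ {v} → ¬ (v ∈ map (i ,_) ⟨ 0 , part μ i ] × v ∈ map (k ,_) ⟨ 0 , part μ k ])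
    disjoint {i} {k} i≢k (v∈ , v∈′) with ∈-map⁻ (i ,_) v∈ | ∈-map⁻ (k ,_) v∈′
    ... | _ , _ , refl | _ , _ , eq = i≢k (cong proj₁ eq)

  ∈diagonal⁺ : ∀ {c i j} → S i j → pos j ℤ.- pos i ≡ c → (i , j) ∈ diagonal μ c
  ∈diagonal⁺ s eq = ∈-filter⁺ (λ (i , j) → (pos j ℤ.- pos i) ℤ.≟ _) (∈cells⁺ s) eq

  ∈diagonal⁻ : ∀ {c i j} → (i , j) ∈ diagonal μ c → S i j × pos j ℤ.- pos i ≡ c
  ∈diagonal⁻ {c} d∈ with ∈-filter⁻ (λ (i , j) → (pos j ℤ.- pos i) ℤ.≟ c) {xs = cells μ} d∈
  ... | c∈ , eq = ∈cells⁻ c∈ , eq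

  Hole-conjugate : ∀ {J} → 1 ≤ J → J ≤ part μ 1 → S (conjugate μ J) J × ¬ S (suc (conjugate μ J)) J
  Hole-conjugate 1≤J J≤ = ≤conjugate⇒S (S⇒≤conjugate (S-intro ≤-refl 1≤J J≤)) 1≤J ≤-refl , λ s → <-irrefl refl (S⇒≤conjugate s)

  Hole⇒∈holes : ∀ {i j} → Hole i j → ∃ λ d → d ∈ holes μ ×
    (∀ {k l} → j + k ≡ l + i → pos (suc l) ℤ.- pos k ≡ d ℤ.+ pos 1)
  Hole⇒∈holes {i} {j} H@(hole {I} {J} p q e) = _ ,
    ∈-map⁺ (λ j → pos j ℤ.- pos 1 ℤ.- pos (conjugate μ j)) (∈⟨]⁺ (S-col p) (S-col≤part₁ p)) ,
    λ {k} {l} eq → trans (difference-cong (suc l) k J (conjugate μ J) (sym (trans (Hole.slice (Hole-diagonal eq H)) (cong (λ x → suc (l + x)) I≡))))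
      (sym (hole-position (pos J) (pos (conjugate μ J))))
    where
    I≡ : I ≡ conjugate μ J
    I≡ = ≤-antisym (S⇒≤conjugate p) (≮⇒≥ λ I< → q (≤conjugate⇒S (s≤s z≤n) (S-col p) I<))

  ∈holes⇒Hole : ∀ {d i j} → d ∈ holes μ → pos (suc j) ℤ.- pos i ≡ d ℤ.+ pos 1 → Hole i j
  ∈holes⇒Hole {i = i} {j} d∈ eq with ∈-map⁻ (λ j → pos j ℤ.- pos 1 ℤ.- pos (conjugate μ j)) d∈
  ... | J , J∈ , refl with ∈⟨]⁻ J∈
  ...   | 1≤J , J≤ with Hole-conjugate 1≤J J≤
  ...     | p , q = hole p q (sym (difference-injective (suc j) i J (conjugate μ J) (trans eq (hole-position (pos J) (pos (conjugate μ J))))))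

  Particle⇒∈particles : ∀ {i j} → Particle i j → ∃ λ d → d ∈ particles μ ×
    (∀ {k l} → j + k ≡ l + i → pos l ℤ.- pos k ≡ d × pos (suc l) ℤ.- pos k ≡ d ℤ.+ pos 1)
  Particle⇒∈particles {i} {j} P@(particle {I} {J} p q e) = _ ,
    ∈-map⁺ (λ i → pos (part μ i) ℤ.- pos i) (∈⟨]⁺ (S-row p) (S-row≤ℓ p)) ,
    λ {k} {l} eq → let slice = trans (cong (_+ k) (sym J≡)) (Particle.slice (Particle-diagonal eq P)) in
      difference-cong l k (part μ I) I (sym slice) ,
      trans (difference-cong (suc l) k (suc (part μ I)) I (sym (cong suc slice))) (sym (particle-position (pos (part μ I)) (pos I)))
    where
    J≡ : J ≡ part μ I
    J≡ = ≤-antisym (S-col≤part p) (≮⇒≥ λ J< → q (S-intro (S-row p) (s≤s z≤n) J<))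

  ∈particles⇒Particle : ∀ {d i j} → d ∈ particles μ → pos j ℤ.- pos i ≡ d → Particle i j
  ∈particles⇒Particle {i = i} {j} d∈ eq with ∈-map⁻ (λ i → pos (part μ i) ℤ.- pos i) d∈
  ... | I , I∈ , refl with ∈⟨]⁻ I∈
  ...   | 1≤I , I≤ = particle (S-intro 1≤I (nth-positive positive I 1≤I I≤) ≤-refl) (λ s → <-irrefl refl (S-col≤part s)) (sym (difference-injective j i (part μ I) I eq))

  -- Reverse plane partitions as fillings

  entry-at : ∀ (Λ : RPP μ) {i j} (s : S i j) → Λ ⟪ i , j ⟫ ≡ RPP.entry Λ (cell i j s)
  entry-at Λ {i} {j} s with inShape? μ i j
  ... | yes _ = refl
  ... | no ¬s = contradiction s ¬s

  RPP-isFilling : (Λ : RPP μ) → IsFilling (Λ ⟪_,_⟫)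
  RPP-isFilling Λ = isFilling-stepwise off
    (λ s s′ → subst₂ _≤_ (sym (entry-at Λ s)) (sym (entry-at Λ s′)) (RPP.col-inc Λ _ _ refl (n≤1+n _)))
    (λ s s′ → subst₂ _≤_ (sym (entry-at Λ s)) (sym (entry-at Λ s′)) (RPP.row-inc Λ _ _ refl (n≤1+n _)))
    where
    off : ∀ {i j} → ¬ S i j → Λ ⟪ i , j ⟫ ≡ 0
    off {i} {j} ¬s with inShape? μ i j
    ... | yes s = contradiction s ¬s
    ... | no _  = refl

  toRPP : ∀ {f} → IsFilling f → RPP μ
  toRPP {f} F = record
    { entry   = λ (cell i j _) → f i j
    ; row-inc = λ { (cell i j _) (cell k l s) refl i≤k → IsFilling.mono F i≤k ≤-refl λ _ → recompute (inShape? μ k l) s }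
    ; col-inc = λ { (cell i j _) (cell k l s) refl j≤l → IsFilling.mono F ≤-refl j≤l λ _ → recompute (inShape? μ k l) s }
    }

  toRPP-at : ∀ {f} (F : IsFilling f) i j → toRPP F ⟪ i , j ⟫ ≡ f i j
  toRPP-at F i j with inShape? μ i j
  ... | yes _ = refl
  ... | no ¬s = sym (IsFilling.off F ¬s)

  ≈⇒⟪⟫≡ : ∀ {Λ Λ′ : RPP μ} → (∀ c → RPP.entry Λ c ≡ RPP.entry Λ′ c) → ∀ i j → Λ ⟪ i , j ⟫ ≡ Λ′ ⟪ i , j ⟫
  ≈⇒⟪⟫≡ eq i j with inShape? μ i j
  ... | yes s = eq (cell i j s)
  ... | no _  = refl

  volume-cong : ∀ {Λ Λ′ : RPP μ} → (∀ c → RPP.entry Λ c ≡ RPP.entry Λ′ c) → volume Λ ≡ volume Λ′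
  volume-cong {Λ} {Λ′} eq = cong sum (map-cong (λ (i , j) → ≈⇒⟪⟫≡ {Λ} {Λ′} eq i j) (cells μ))

  volume-toRPP : ∀ {f} (F : IsFilling f) → volume (toRPP F) ≡ sum (map (λ (i , j) → f i j) (cells μ))
  volume-toRPP F = cong sum (map-cong (λ (i , j) → toRPP-at F i j) (cells μ))

  -- Lozenges and the vanishing of `g`

  record LeftFace (d : ℤ) (Λ : RPP μ) (x : ℕ) : Set where
    constructor leftFace
    field
      {i j h} : ℕ
      in-S    : S i (suc j)
      slice   : pos (suc j) ℤ.- pos i ≡ d ℤ.+ pos 1
      above   : Λ ⟪ i , j ⟫ < h
      below   : h ≤ Λ ⟪ i , suc j ⟫
      height  : x ≡ h + i

  record RightFace (d : ℤ) (Λ : RPP μ) (x : ℕ) : Set where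
    constructor rightFace
    field
      {i j h} : ℕ
      in-S    : S (suc i) (suc j)
      slice   : pos (suc j) ℤ.- pos (suc i) ≡ d
      above   : Λ ⟪ i , suc j ⟫ < h
      below   : h ≤ Λ ⟪ suc i , suc j ⟫
      height  : x ≡ h + suc i

  record TopFace (d : ℤ) (Λ : RPP μ) (x : ℕ) : Set where
    constructor topFace
    field
      {i j}  : ℕ
      in-S   : S i (suc j)
      slice  : pos (suc j) ℤ.- pos i ≡ d ℤ.+ pos 1
      height : x ≡ suc (Λ ⟪ i , suc j ⟫) + i

  leftFace⇒∈O : ∀ {d Λ x} → LeftFace d Λ x → x ∈ O d Λ
  leftFace⇒∈O {d} {Λ} (leftFace {i} s eq <h h≤ refl) =
    ∈-concatMap⁺ (λ (i , j) → map (_+ i) ⟨ Λ ⟪ i , pred j ⟫ , Λ ⟪ i , j ⟫ ]) (lose (∈diagonal⁺ s eq) (∈-map⁺ (_+ i) (∈⟨]⁺ <h h≤)))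

  ∈O⇒leftFace : ∀ {d x} Λ → x ∈ O d Λ → LeftFace d Λ x
  ∈O⇒leftFace {d} {x} Λ x∈ = go (find (∈-concatMap⁻ faces {xs = diagonal μ (d ℤ.+ pos 1)} x∈))
    where
    faces : ℕ × ℕ → List ℕ
    faces (i , j) = map (_+ i) ⟨ Λ ⟪ i , pred j ⟫ , Λ ⟪ i , j ⟫ ]
    go : (∃ λ ij → ij ∈ diagonal μ (d ℤ.+ pos 1) × x ∈ faces ij) → LeftFace d Λ x
    go ((i , j) , ij∈ , p) with ∈diagonal⁻ ij∈ | ∈-map⁻ (_+ i) p
    go ((i , suc j) , ij∈ , p) | s , eq | h , h∈ , e = leftFace s eq (proj₁ (∈⟨]⁻ h∈)) (proj₂ (∈⟨]⁻ h∈)) e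
    go ((i , zero)  , ij∈ , p) | s , eq | _ = contradiction (S-col s) λ ()

  rightFace⇒∈B : ∀ {d Λ x} → RightFace d Λ x → x ∈ B d Λ
  rightFace⇒∈B {d} {Λ} (rightFace {i} s eq <h h≤ refl) =
    ∈-concatMap⁺ (λ (i , j) → map (_+ i) ⟨ Λ ⟪ pred i , j ⟫ , Λ ⟪ i , j ⟫ ]) (lose (∈diagonal⁺ s eq) (∈-map⁺ (_+ suc i) (∈⟨]⁺ <h h≤)))

  ∈B⇒rightFace : ∀ {d x} Λ → x ∈ B d Λ → RightFace d Λ x
  ∈B⇒rightFace {d} {x} Λ x∈ = go (find (∈-concatMap⁻ faces {xs = diagonal μ d} x∈))
    where
    faces : ℕ × ℕ → List ℕ
    faces (i , j) = map (_+ i) ⟨ Λ ⟪ pred i , j ⟫ , Λ ⟪ i , j ⟫ ]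
    go : (∃ λ ij → ij ∈ diagonal μ d × x ∈ faces ij) → RightFace d Λ x
    go ((i , j) , ij∈ , p) with ∈diagonal⁻ ij∈ | ∈-map⁻ (_+ i) p
    go ((suc i , suc j) , ij∈ , p) | s , eq | h , h∈ , e = rightFace s eq (proj₁ (∈⟨]⁻ h∈)) (proj₂ (∈⟨]⁻ h∈)) e
    go ((suc i , zero)  , ij∈ , p) | s , eq | _ = contradiction (S-col s) λ ()
    go ((zero , j)      , ij∈ , p) | s , eq | _ = contradiction (S-row s) λ ()

  topFace⇒∈T : ∀ {d Λ x} → TopFace d Λ x → x ∈ T d Λ
  topFace⇒∈T {d} {Λ} (topFace {i} {j} s eq refl) = subst (_∈ T d Λ) (+-comm (Λ ⟪ i , suc j ⟫ + i) 1)
    (∈-map⁺ (λ (i , j) → Λ ⟪ i , j ⟫ + i + 1) (∈diagonal⁺ s eq))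

  ∈T⇒topFace : ∀ {d x} Λ → x ∈ T d Λ → TopFace d Λ x
  ∈T⇒topFace {d} {x} Λ x∈ = go (∈-map⁻ (λ (i , j) → Λ ⟪ i , j ⟫ + i + 1) x∈)
    where
    go : (∃ λ ij → ij ∈ diagonal μ (d ℤ.+ pos 1) × x ≡ Λ ⟪ proj₁ ij , proj₂ ij ⟫ + proj₁ ij + 1) → TopFace d Λ x
    go ((i , j) , ij∈ , e) with ∈diagonal⁻ ij∈
    go ((i , suc j) , ij∈ , e) | s , eq = topFace s eq (trans e (+-comm _ 1))
    go ((i , zero)  , ij∈ , e) | s , eq = contradiction (S-col s) λ ()

  module _ (Λ Λ′ : RPP μ) where
    private
      module r = IsFilling (RPP-isFilling Λ′)
      module b = IsFilling (RPP-isFilling Λ)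

    g≡0⇒uncoupled : g Λ Λ′ ≡ 0 → Uncoupled (Λ ⟪_,_⟫) (Λ′ ⟪_,_⟫)
    g≡0⇒uncoupled g≡0 = record { hole-free = hole-free ; particle-free = particle-free }
      where
      O∩[T∪O] : ∀ {d x} → d ∈ holes μ → LeftFace d Λ x → TopFace d Λ′ x ⊎ LeftFace d Λ′ x → ⊥
      O∩[T∪O] {d} d∈ o = Sum.[ ∩-empty⁻ (m+n≡0⇒m≡0 ∣ O d Λ ∩ T d Λ′ ∣ z) (leftFace⇒∈O o) ∘ topFace⇒∈T
                             , ∩-empty⁻ (m+n≡0⇒n≡0 ∣ O d Λ ∩ T d Λ′ ∣ z) (leftFace⇒∈O o) ∘ leftFace⇒∈O ]
        where
        z : ∣ O d Λ ∩ T d Λ′ ∣ + ∣ O d Λ ∩ O d Λ′ ∣ ≡ 0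
        z = ∑-zero⁻ {holes μ} (m+n≡0⇒m≡0 _ g≡0) d∈

      [B∪T]∩B : ∀ {d x} → d ∈ particles μ → RightFace d Λ x ⊎ TopFace d Λ x → RightFace d Λ′ x → ⊥
      [B∪T]∩B {d} d∈ f o = Sum.[ (λ o′ → ∩-empty⁻ (m+n≡0⇒m≡0 ∣ B d Λ ∩ B d Λ′ ∣ z) (rightFace⇒∈B o′) (rightFace⇒∈B o))
                               , (λ o′ → ∩-empty⁻ (m+n≡0⇒n≡0 ∣ B d Λ ∩ B d Λ′ ∣ z) (topFace⇒∈T o′) (rightFace⇒∈B o)) ] f
        where
        z : ∣ B d Λ ∩ B d Λ′ ∣ + ∣ T d Λ ∩ B d Λ′ ∣ ≡ 0
        z = ∑-zero⁻ {particles μ} (m+n≡0⇒n≡0 (∑[ holes μ ] (λ d → ∣ O d Λ ∩ T d Λ′ ∣ + ∣ O d Λ ∩ O d Λ′ ∣)) g≡0) d∈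

      hole-free : ∀ {i j k l h h′} → Hole i j → S i (suc j) → S k (suc l) → j + k ≡ l + i →
        Λ ⟪ i , j ⟫ < h → h ≤ Λ ⟪ i , suc j ⟫ → Λ′ ⟪ k , l ⟫ < h′ → h′ ≤ suc (Λ′ ⟪ k , suc l ⟫) → h + i ≢ h′ + k
      hole-free {k = k} H s t eq b< ≤b r< ≤r e with Hole⇒∈holes H
      ... | d , d∈ , on-slice = O∩[T∪O] d∈ (leftFace s (on-slice refl) b< ≤b refl)
        -- The top height of the red interval is the top face; all lower ones are left faces.
        (Sum.[ (λ { (s≤s ≤r′) → inj₂ (leftFace t (on-slice eq) r< ≤r′ e) })
             , (λ h′≡ → inj₁ (topFace t (on-slice eq) (trans e (cong (_+ k) h′≡)))) ] (m≤n⇒m<n∨m≡n ≤r))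

      particle-free : ∀ {i j k l h h′} → Particle i j → S (suc i) (suc j) → S (suc k) (suc l) → j + k ≡ l + i →
        Λ′ ⟪ i , suc j ⟫ < h → h ≤ Λ′ ⟪ suc i , suc j ⟫ → Λ ⟪ k , suc l ⟫ ≤ h′ → h′ ≤ Λ ⟪ suc k , suc l ⟫ → h + i ≢ h′ + k
      particle-free {i} {j} {k} {l} {h} {h′} P s t eq r< ≤r b≤ ≤b e with Particle⇒∈particles P
      ... | d , d∈ , on-slice = [B∪T]∩B d∈
          -- The lowest height of the blue interval is the top face; all higher ones are right
          -- faces.
          (Sum.[ (λ b< → inj₁ (rightFace t (proj₁ (on-slice (trans (+-suc j k) (cong suc eq)))) b< ≤b (+-suc-cong e)))
               , inj₂ ∘ top k t eq e ] (m≤n⇒m<n∨m≡n b≤))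
          (rightFace s (proj₁ (on-slice (+-suc j i))) r< ≤r refl)
        where
        +-suc-cong : ∀ {h i h′ k} → h + i ≡ h′ + k → h + suc i ≡ h′ + suc k
        +-suc-cong {h} {i} {h′} {k} e = trans (+-suc h i) (trans (cong suc e) (sym (+-suc h′ k)))
        top : ∀ k → S (suc k) (suc l) → j + k ≡ l + i → h + i ≡ h′ + k → Λ ⟪ k , suc l ⟫ ≡ h′ → TopFace d Λ (h + suc i)
        -- Row 0 has no top face, but there the height `h′` is 0, whereas `h` is positive.
        top zero    t eq e refl = contradiction (trans e (trans (+-identityʳ _) (b.row₀ {suc l})))
          (>⇒≢ (≤-trans (s≤s z≤n) (≤-trans r< (m≤m+n h i))))
        top (suc k) t eq e refl = topFace (S-down (s≤s z≤n) (s≤s z≤n) (n≤1+n _) ≤-refl t) (proj₂ (on-slice eq))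
          (trans (+-suc h i) (cong suc e))

    uncoupled⇒g≡0 : Uncoupled (Λ ⟪_,_⟫) (Λ′ ⟪_,_⟫) → g Λ Λ′ ≡ 0
    uncoupled⇒g≡0 un = cong₂ _+_
      (∑-zero⁺ (holes μ) λ d∈ → cong₂ _+_
        (∩-empty⁺ _ _ λ x∈ x∈′ → O∩T d∈ (∈O⇒leftFace Λ x∈) (∈T⇒topFace Λ′ x∈′))
        (∩-empty⁺ _ _ λ x∈ x∈′ → O∩O d∈ (∈O⇒leftFace Λ x∈) (∈O⇒leftFace Λ′ x∈′)))
      (∑-zero⁺ (particles μ) λ d∈ → cong₂ _+_
        (∩-empty⁺ _ _ λ x∈ x∈′ → B∩B d∈ (∈B⇒rightFace Λ x∈) (∈B⇒rightFace Λ′ x∈′))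
        (∩-empty⁺ _ _ λ x∈ x∈′ → T∩B d∈ (∈T⇒topFace Λ x∈) (∈B⇒rightFace Λ′ x∈′)))
      where
      open Uncoupled un

      same-diagonal : ∀ i j k l {c} → pos (suc j) ℤ.- pos i ≡ c → pos (suc l) ℤ.- pos k ≡ c → j + k ≡ l + i
      same-diagonal i j k l eq eq′ = suc-injective (difference-injective (suc j) i (suc l) k (trans eq (sym eq′)))

      O∩T : ∀ {d x} → d ∈ holes μ → LeftFace d Λ x → TopFace d Λ′ x → ⊥
      O∩T d∈ (leftFace {i} {j} s eq b< ≤b e) (topFace {k} {l} t eq′ e′) =
        hole-free (∈holes⇒Hole d∈ eq) s t (same-diagonal i j k l eq eq′)
          b< ≤b (s≤s (r.mono ≤-refl (n≤1+n l) λ _ → t)) ≤-refl (trans (sym e) e′)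

      O∩O : ∀ {d x} → d ∈ holes μ → LeftFace d Λ x → LeftFace d Λ′ x → ⊥
      O∩O d∈ (leftFace {i} {j} s eq b< ≤b e) (leftFace {k} {l} t eq′ r< ≤r e′) =
        hole-free (∈holes⇒Hole d∈ eq) s t (same-diagonal i j k l eq eq′)
          b< ≤b r< (≤-trans ≤r (n≤1+n _)) (trans (sym e) e′)

      B∩B : ∀ {d x} → d ∈ particles μ → RightFace d Λ x → RightFace d Λ′ x → ⊥
      B∩B d∈ (rightFace {k} {l} {h′} t eq′ b< ≤b e′) (rightFace {i} {j} {h} s eq r< ≤r e) =
        particle-free (Particle-pred (∈particles⇒Particle d∈ eq)) s t
          (suc-injective (trans (sym (+-suc j k)) (trans (same-diagonal (suc i) j (suc k) l eq eq′) (+-suc l i))))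
          r< ≤r (<⇒≤ b<) ≤b (suc-injective (trans (sym (+-suc h i)) (trans (sym e) (trans e′ (+-suc h′ k)))))

      T∩B : ∀ {d x} → d ∈ particles μ → TopFace d Λ x → RightFace d Λ′ x → ⊥
      T∩B d∈ (topFace {k} {l} t eq′ e′) (rightFace {i} {j} {h} s refl r< ≤r e) =
        particle-free P s t′ diag r< ≤r ≤-refl (b.mono (n≤1+n k) ≤-refl λ _ → t′)
          (suc-injective (trans (sym (+-suc h i)) (trans (sym e) e′)))
        where
        P : Particle i j
        P = Particle-pred (∈particles⇒Particle d∈ refl)
        diag : j + k ≡ l + i
        -- The right face belongs to `(suc i , suc j)` on diagonal `d`, so `(i , suc j)` lies on the
        -- next diagonal, which is that of the top face.
        diag = same-diagonal i j k l
          (trans (difference-cong (suc j) i (2 + j) (suc i) (cong suc (+-suc j i)))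
                 (sym (particle-position (pos (suc j)) (pos (suc i)))))
          eq′
        t′ : S (suc k) (suc l)
        -- The top face only supplies the cell `(k , suc l)`; in a particle slice the cell above it
        -- is in the shape as well.
        t′ = Particle⇒S-up (Particle-diagonal diag P) t

  -- Volume

  split-volume : ∀ {p} (pF : IsFilling p) → let open Splitting pF in
    volume (toRPP (split-isFilling blue)) + volume (toRPP (split-isFilling red)) ≡ sum (map (λ (i , j) → p i j) (cells μ))
  split-volume {p} pF = begin
    volume (toRPP (split-isFilling blue)) + volume (toRPP (split-isFilling red))
      ≡⟨ cong₂ _+_ (volume-toRPP (split-isFilling blue)) (volume-toRPP (split-isFilling red)) ⟩
    sum (map (weight ∘ target ∘ (blue ,_)) (cells μ)) + sum (map (weight ∘ target ∘ (red ,_)) (cells μ))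
      ≡⟨ cong₂ (λ xs ys → sum xs + sum ys) (map-∘ (cells μ)) (map-∘ (cells μ)) ⟩
    sum (map (weight ∘ target) (map (blue ,_) (cells μ))) + sum (map (weight ∘ target) (map (red ,_) (cells μ)))
      ≡⟨ sum-++ (map (weight ∘ target) (map (blue ,_) (cells μ))) _ ⟨
    sum (map (weight ∘ target) (map (blue ,_) (cells μ)) ++ map (weight ∘ target) (map (red ,_) (cells μ)))
      ≡⟨ cong sum (map-++ (weight ∘ target) (map (blue ,_) (cells μ)) _) ⟨
    sum (map (weight ∘ target) coloured)
      -- Coloured cells whose target leaves the shape have weight 0; the others correspond to the
      -- cells by `source`.
      ≡⟨ sum-reindex target (λ (i , j) → source (depth i j) i j) coloured-unique cells-unique cells? source-in
           source∘target weight (λ ij∉ → IsFilling.off pF (ij∉ ∘ ∈cells⁺)) ⟩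
    sum (map weight (cells μ)) ∎
    where
    open ≡-Reasoning
    open Splitting pF
    weight : ℕ × ℕ → ℕ
    weight (i , j) = p i j
    coloured : List (Colour × ℕ × ℕ)
    coloured = map (blue ,_) (cells μ) ++ map (red ,_) (cells μ)
    ∈coloured⁺ : ∀ c {i j} → S i j → (c , i , j) ∈ coloured
    ∈coloured⁺ blue s = ∈-++⁺ˡ (∈-map⁺ (blue ,_) (∈cells⁺ s))
    ∈coloured⁺ red  s = ∈-++⁺ʳ (map (blue ,_) (cells μ)) (∈-map⁺ (red ,_) (∈cells⁺ s))
    ∈coloured⁻ : ∀ {c i j} → (c , i , j) ∈ coloured → S i j
    ∈coloured⁻ x∈ with ∈-++⁻ (map (blue ,_) (cells μ)) x∈
    ... | inj₁ y with ∈-map⁻ (blue ,_) y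
    ...   | _ , ij∈ , refl = ∈cells⁻ ij∈
    ∈coloured⁻ x∈ | inj₂ y with ∈-map⁻ (red ,_) y
    ...   | _ , ij∈ , refl = ∈cells⁻ ij∈
    coloured-unique : Unique coloured
    coloured-unique = Unique.++⁺ (Unique.map⁺ (cong proj₂) cells-unique) (Unique.map⁺ (cong proj₂) cells-unique) disjoint
      where
      disjoint : ∀ {x} → ¬ (x ∈ map (blue ,_) (cells μ) × x ∈ map (red ,_) (cells μ))
      disjoint (x∈ , x∈′) with ∈-map⁻ (blue ,_) x∈ | ∈-map⁻ (red ,_) x∈′
      ... | _ , _ , refl | _ , _ , ()
    cells? : ∀ ij → Dec (ij ∈ cells μ)
    cells? (i , j) = map′ ∈cells⁺ ∈cells⁻ (inShape? μ i j)
    source-in : ∀ {ij} → ij ∈ cells μ → let (i , j) = ij in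
      source (depth i j) i j ∈ coloured × target (source (depth i j) i j) ≡ ij
    source-in {i , j} ij∈ with source-S (∈cells⁻ ij∈)
    ... | c , k , eq , s , _ = subst (_∈ coloured) (sym eq) (∈coloured⁺ c s) , target-source (∈cells⁻ ij∈)
    source∘target : ∀ {x} → x ∈ coloured → target x ∈ cells μ →
      source (depth (proj₁ (target x)) (proj₂ (target x))) (proj₁ (target x)) (proj₂ (target x)) ≡ x
    source∘target {c , i , j} x∈ t∈ = source-target c (∈coloured⁻ x∈) (∈cells⁻ t∈)

  -- The two mutually inverse maps

  Uncoupled-resp : ∀ {b b′ r r′} → (∀ i j → b i j ≡ b′ i j) → (∀ i j → r i j ≡ r′ i j) → Uncoupled b r → Uncoupled b′ r′
  Uncoupled-resp b≗ r≗ un = record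
    { hole-free = λ {i} {j} {k} {l} H s t eq b< ≤b r< ≤r → hole-free H s t eq
        (subst (_< _) (sym (b≗ i j)) b<) (subst (_ ≤_) (sym (b≗ i (suc j))) ≤b)
        (subst (_< _) (sym (r≗ k l)) r<) (subst (λ x → _ ≤ suc x) (sym (r≗ k (suc l))) ≤r)
    ; particle-free = λ {i} {j} {k} {l} P s t eq r< ≤r b≤ ≤b → particle-free P s t eq
        (subst (_< _) (sym (r≗ i (suc j))) r<) (subst (_ ≤_) (sym (r≗ (suc i) (suc j))) ≤r)
        (subst (_≤ _) (sym (b≗ k (suc l))) b≤) (subst (_ ≤_) (sym (b≗ (suc k) (suc l))) ≤b)
    }
    where open Uncoupled un

  paint-cong : ∀ {b b′ r r′} → (∀ i j → b i j ≡ b′ i j) → (∀ i j → r i j ≡ r′ i j) → ∀ t → paint b r t ≡ paint b′ r′ t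
  paint-cong b≗ r≗ (blue , i , j) = b≗ i j
  paint-cong b≗ r≗ (red  , i , j) = r≗ i j

  _≈_ : RPP μ → RPP μ → Set
  Λ ≈ Λ′ = ∀ c → RPP.entry Λ c ≡ RPP.entry Λ′ c

  splitRPP : Colour → RPP μ → RPP μ
  splitRPP c Π = toRPP (Splitting.split-isFilling (RPP-isFilling Π) c)

  splitRPP-cong : ∀ c {Π Π′} → Π ≈ Π′ → splitRPP c Π ≈ splitRPP c Π′
  splitRPP-cong c {Π} {Π′} eq (cell i j _) = ≈⇒⟪⟫≡ {Π} {Π′} eq (i ∸ (depth i j ∸ bit c)) (j ∸ (depth i j ∸ bit c))

  splitRPP-uncoupled : ∀ Π → g (splitRPP blue Π) (splitRPP red Π) ≡ 0
  splitRPP-uncoupled Π = uncoupled⇒g≡0 (splitRPP blue Π) (splitRPP red Π)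
    (Uncoupled-resp (λ i j → sym (toRPP-at (split-isFilling blue) i j)) (λ i j → sym (toRPP-at (split-isFilling red) i j)) split-uncoupled)
    where open Splitting (RPP-isFilling Π)

  splitRPP-volume : ∀ Π → volume (splitRPP blue Π) + volume (splitRPP red Π) ≡ volume Π
  splitRPP-volume Π = split-volume (RPP-isFilling Π)

  module _ (Λ Λ′ : RPP μ) (g≡0 : g Λ Λ′ ≡ 0) where
    open Interlacing (RPP-isFilling Λ) (RPP-isFilling Λ′) (g≡0⇒uncoupled Λ Λ′ g≡0)

    mergeRPP : RPP μ
    mergeRPP = toRPP merge-isFilling

    split-mergeRPP-blue : splitRPP blue mergeRPP ≈ Λ
    split-mergeRPP-blue (cell i j s) = trans (toRPP-at merge-isFilling (i ∸ depth i j) (j ∸ depth i j))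
      (trans (split-merge-blue (recompute (inShape? μ i j) s)) (entry-at Λ (recompute (inShape? μ i j) s)))

    split-mergeRPP-red : splitRPP red mergeRPP ≈ Λ′
    split-mergeRPP-red (cell i j s) = trans (toRPP-at merge-isFilling (i ∸ (depth i j ∸ 1)) (j ∸ (depth i j ∸ 1)))
      (trans (split-merge-red (recompute (inShape? μ i j) s)) (entry-at Λ′ (recompute (inShape? μ i j) s)))

    -- Splitting preserves the total volume and recovers the pair from its merge, so no separate
    -- count is needed.
    mergeRPP-volume : volume mergeRPP ≡ volume Λ + volume Λ′
    mergeRPP-volume = trans (sym (splitRPP-volume mergeRPP))
      (cong₂ _+_ (volume-cong {splitRPP blue mergeRPP} {Λ} split-mergeRPP-blue)
                 (volume-cong {splitRPP red mergeRPP} {Λ′} split-mergeRPP-red))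

  mergeRPP-cong : ∀ {Λ Λ′ Ξ Ξ′} z z′ → Λ ≈ Ξ → Λ′ ≈ Ξ′ → mergeRPP Λ Λ′ z ≈ mergeRPP Ξ Ξ′ z′
  mergeRPP-cong {Λ} {Λ′} {Ξ} {Ξ′} z z′ eq eq′ (cell i j _) =
    paint-cong (≈⇒⟪⟫≡ {Λ} {Ξ} eq) (≈⇒⟪⟫≡ {Λ′} {Ξ′} eq′) (source (depth i j) i j)

  merge-splitRPP : ∀ Π → mergeRPP (splitRPP blue Π) (splitRPP red Π) (splitRPP-uncoupled Π) ≈ Π
  merge-splitRPP Π (cell i j s) = trans
    (paint-cong (toRPP-at (split-isFilling blue)) (toRPP-at (split-isFilling red)) (source (depth i j) i j))
    (trans (merge-split (Π ⟪_,_⟫) (recompute (inShape? μ i j) s)) (entry-at Π (recompute (inShape? μ i j) s)))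
    where open Splitting (RPP-isFilling Π)

  uncoupledPairs↔RPPs : ∀ n → Inverse (UncoupledPairs μ n) (RPPsOfVolume μ n)
  uncoupledPairs↔RPPs n = record
    { to        = λ ((Λ , Λ′) , z , v) → mergeRPP Λ Λ′ z , trans (mergeRPP-volume Λ Λ′ z) v
    ; from      = λ (Π , v) → (splitRPP blue Π , splitRPP red Π) , splitRPP-uncoupled Π , trans (splitRPP-volume Π) v
    ; to-cong   = λ { {(Λ , Λ′) , z , _} {(Ξ , Ξ′) , z′ , _} (eq , eq′) → mergeRPP-cong {Λ} {Λ′} {Ξ} {Ξ′} z z′ eq eq′ }
    ; from-cong = λ { {Π , _} {Π′ , _} eq → splitRPP-cong blue {Π} {Π′} eq , splitRPP-cong red {Π} {Π′} eq }
    ; inverse   =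
        (λ { {Π , _} {(Λ , Λ′) , z , _} (eq , eq′) c → trans
          (mergeRPP-cong {Λ} {Λ′} {splitRPP blue Π} {splitRPP red Π} z (splitRPP-uncoupled Π) eq eq′ c)
          (merge-splitRPP Π c) })
      , (λ { {(Λ , Λ′) , z , _} {Π , _} eq →
          (λ c → trans (splitRPP-cong blue {Π} {mergeRPP Λ Λ′ z} eq c) (split-mergeRPP-blue Λ Λ′ z c)) ,
          (λ c → trans (splitRPP-cong red {Π} {mergeRPP Λ Λ′ z} eq c) (split-mergeRPP-red Λ Λ′ z c)) })
    }

mainTheorem2 : (μ : Partition) (n : ℕ) → Bijection (UncoupledPairs μ n) (RPPsOfVolume μ n)
mainTheorem2 μ n = Inverse⇒Bijection (Shape.uncoupledPairs↔RPPs μ n)
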